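{- Let $G$ be a group. Suppose $\omega$ is a commensurability class of approximate subgroups of $G$, equal to $\chi(g)$ for some homogeneous quasimorphism $g:G\to\mathbb{R}^n$, and also to $\chi(f)$ for some homomorphism $f:G\to L$ into a connected locally compact group with dense image. Then $g$ is a homomorphism.
   Context: Subsets of a group are commensurable if each is covered by finitely many right translates of the other; a symmetric subset $\Lambda$ ($1\in\Lambda=\Lambda^{ -1}$) is an approximate subgroup if $\Lambda$ and $\Lambda^2$ are commensurable; its commensurability class is the set of approximate subgroups commensurable to it. A homogeneous quasimorphism $g:G\to\mathbb{R}^n$ is a map such that $g(xy)-g(x)-g(y)$ is bounded on $G^2$ and $g(x^k)=kg(x)$ for all $x\in G,k\in\mathbb{Z}$; $\chi(g)$ is the commensurability class of the approximate subgroup $YY^{ -1}$, where $Y=g^{ -1}(W)$ with $W$ any compact neighborhood of a compact symmetric error set $K\subset\mathbb{R}^n$ (with $g(xy)-g(x)-g(y)\in K$ for all $x,y$); it is independent of choices. For a homomorphism $f$ into a locally compact group, $\chi(f)$ is the commensurability class of $YY^{ -1}$ (equivalently, of $Y$ when symmetric) for $Y$ the preimage of any compact neighborhood of the identity. -}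

module Defs where

open import Algebra.Bundles using (Group; AbelianGroup)
import Algebra.Construct.Pointwise as Pointwise
open import Algebra.Definitions.RawMonoid using () renaming (_×_ to multiple)
open import Algebra.Properties.Group using (⁻¹-involutive)
open import Data.Fin.Base using (Fin)
open import Data.Integer.Base using (ℤ; +_; -[1+_])
open import Data.List.Base using (List)
open import Data.List.Relation.Unary.All using (All)
open import Data.List.Relation.Unary.Any using (Any)
open import Data.Nat.Base as ℕ using (ℕ; _⊔_)
import Data.Nat.Properties as ℕ
open import Data.Product.Base using (∃-syntax; _×_; _,_)
open import Data.Product.Relation.Binary.Pointwise.NonDependent using (×-setoid)
open import Data.Rational.Base as ℚ using (ℚ; 0ℚ; ½)
import Data.Rational.Properties as ℚ
open import Data.Sum.Base using (inj₁; inj₂)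
open import Data.Unit.Base using (tt)
open import Level using (Level; 0ℓ; Lift; lift; suc) renaming (_⊔_ to _⊔ˡ_)
open import Relation.Binary.Bundles using (Setoid)
open import Relation.Binary.Definitions using (_Respects_)
open import Relation.Binary.PropositionalEquality
  using (_≡_; refl; sym; trans; cong; subst; module ≡-Reasoning)
open import Relation.Nullary.Negation using (¬_)
open import Relation.Unary
  using (Pred; _∈_; _⊆_; _≐_; _∩_; _∪_; _≬_; ⋃; U; _⊢_; Satisfiable; Universal)

private
  half-pos : ∀ {ε} → 0ℚ ℚ.< ε → 0ℚ ℚ.< ½ ℚ.* ε
  half-pos {ε} 0<ε = subst (ℚ._< ½ ℚ.* ε) (ℚ.*-zeroʳ ½) (ℚ.*-monoʳ-<-pos ½ 0<ε)

  half+half : ∀ ε → ½ ℚ.* ε ℚ.+ ½ ℚ.* ε ≡ ε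
  half+half ε = trans (sym (ℚ.*-distribʳ-+ ε ½ ½)) (ℚ.*-identityˡ ε)

  sub-+ : ∀ a b c d → (a ℚ.+ b) ℚ.- (c ℚ.+ d) ≡ (a ℚ.- c) ℚ.+ (b ℚ.- d)
  sub-+ a b c d = begin
    (a ℚ.+ b) ℚ.+ ℚ.- (c ℚ.+ d)           ≡⟨ cong ((a ℚ.+ b) ℚ.+_) (ℚ.neg-distrib-+ c d) ⟩
    (a ℚ.+ b) ℚ.+ (ℚ.- c ℚ.+ ℚ.- d)       ≡⟨ ℚ.+-assoc a b _ ⟩
    a ℚ.+ (b ℚ.+ (ℚ.- c ℚ.+ ℚ.- d))       ≡⟨ cong (a ℚ.+_) (sym (ℚ.+-assoc b (ℚ.- c) (ℚ.- d))) ⟩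
    a ℚ.+ ((b ℚ.+ ℚ.- c) ℚ.+ ℚ.- d)       ≡⟨ cong (λ z → a ℚ.+ (z ℚ.+ ℚ.- d)) (ℚ.+-comm b (ℚ.- c)) ⟩
    a ℚ.+ ((ℚ.- c ℚ.+ b) ℚ.+ ℚ.- d)       ≡⟨ cong (a ℚ.+_) (ℚ.+-assoc (ℚ.- c) b (ℚ.- d)) ⟩
    a ℚ.+ (ℚ.- c ℚ.+ (b ℚ.+ ℚ.- d))       ≡⟨ sym (ℚ.+-assoc a (ℚ.- c) _) ⟩
    (a ℚ.- c) ℚ.+ (b ℚ.- d)               ∎
    where open ≡-Reasoning

  cancel : ∀ p q → (p ℚ.- q) ℚ.+ q ≡ p
  cancel p q = trans (ℚ.+-assoc p (ℚ.- q) q)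
    (trans (cong (p ℚ.+_) (ℚ.+-inverseˡ q)) (ℚ.+-identityʳ p))

  telescope : ∀ p q r → (p ℚ.- q) ℚ.+ (q ℚ.- r) ≡ p ℚ.- r
  telescope p q r = trans (sym (ℚ.+-assoc (p ℚ.- q) q (ℚ.- r))) (cong (ℚ._- r) (cancel p q))

  neg-sub : ∀ p q → ℚ.- (p ℚ.- q) ≡ q ℚ.- p
  neg-sub p q = trans (ℚ.neg-distrib-+ p (ℚ.- q))
    (trans (ℚ.+-comm (ℚ.- p) _) (cong (ℚ._- p) (⁻¹-involutive ℚ.+-0-group q)))

  abs-sub-comm : ∀ p q → ℚ.∣ p ℚ.- q ∣ ≡ ℚ.∣ q ℚ.- p ∣
  abs-sub-comm p q = trans (sym (ℚ.∣-p∣≡∣p∣ (p ℚ.- q))) (cong ℚ.∣_∣ (neg-sub p q))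

  triangle : ∀ p q r → ℚ.∣ p ℚ.- r ∣ ℚ.≤ ℚ.∣ p ℚ.- q ∣ ℚ.+ ℚ.∣ q ℚ.- r ∣
  triangle p q r = subst (λ z → ℚ.∣ z ∣ ℚ.≤ ℚ.∣ p ℚ.- q ∣ ℚ.+ ℚ.∣ q ℚ.- r ∣)
    (telescope p q r) (ℚ.∣p+q∣≤∣p∣+∣q∣ (p ℚ.- q) (q ℚ.- r))

  ∣self-sub∣≤ : ∀ p {ε} → 0ℚ ℚ.< ε → ℚ.∣ p ℚ.- p ∣ ℚ.≤ ε
  ∣self-sub∣≤ p 0<ε = subst (ℚ._≤ _) (sym (cong ℚ.∣_∣ (ℚ.+-inverseʳ p))) (ℚ.<⇒≤ 0<ε)

  ≡⇒∣-∣≤ : ∀ {p q ε} → 0ℚ ℚ.< ε → p ≡ q → ℚ.∣ p ℚ.- q ∣ ℚ.≤ ε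
  ≡⇒∣-∣≤ {p} 0<ε refl = ∣self-sub∣≤ p 0<ε

  abs-sub-≤ : ∀ p q → ℚ.∣ p ∣ ℚ.- ℚ.∣ q ∣ ℚ.≤ ℚ.∣ p ℚ.- q ∣
  abs-sub-≤ p q = ℚ.≤-trans
    (ℚ.+-monoˡ-≤ (ℚ.- ℚ.∣ q ∣)
      (subst (λ z → ℚ.∣ z ∣ ℚ.≤ ℚ.∣ p ℚ.- q ∣ ℚ.+ ℚ.∣ q ∣) (cancel p q)
        (ℚ.∣p+q∣≤∣p∣+∣q∣ (p ℚ.- q) q)))
    (ℚ.≤-reflexive (trans (ℚ.+-assoc ℚ.∣ p ℚ.- q ∣ ℚ.∣ q ∣ (ℚ.- ℚ.∣ q ∣))
      (trans (cong (ℚ.∣ p ℚ.- q ∣ ℚ.+_) (ℚ.+-inverseʳ ℚ.∣ q ∣)) (ℚ.+-identityʳ _))))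

  abs-elim : ∀ p {r} → p ℚ.≤ r → ℚ.- p ℚ.≤ r → ℚ.∣ p ∣ ℚ.≤ r
  abs-elim p {r} p≤r -p≤r with ℚ.∣p∣≡p∨∣p∣≡-p p
  ... | inj₁ eq = subst (ℚ._≤ r) (sym eq) p≤r
  ... | inj₂ eq = subst (ℚ._≤ r) (sym eq) -p≤r

  reverse-triangle : ∀ p q → ℚ.∣ ℚ.∣ p ∣ ℚ.- ℚ.∣ q ∣ ∣ ℚ.≤ ℚ.∣ p ℚ.- q ∣
  reverse-triangle p q = abs-elim _ (abs-sub-≤ p q)
    (subst (ℚ._≤ ℚ.∣ p ℚ.- q ∣) (sym (neg-sub ℚ.∣ p ∣ ℚ.∣ q ∣))
      (subst (ℚ.∣ q ∣ ℚ.- ℚ.∣ p ∣ ℚ.≤_) (abs-sub-comm q p) (abs-sub-≤ q p)))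

  split-≤ : ∀ {p q ε} → p ℚ.≤ ½ ℚ.* ε → q ℚ.≤ ½ ℚ.* ε → p ℚ.+ q ℚ.≤ ε
  split-≤ {p} {q} {ε} p≤ q≤ = subst (p ℚ.+ q ℚ.≤_) (half+half ε) (ℚ.+-mono-≤ p≤ q≤)

-- Cauchy sequences of rationals, with _≈ᴿ_ as equality.
record ℝ : Set where
  no-eta-equality
  constructor mkℝ
  field
    seq    : ℕ → ℚ
    cauchy : ∀ ε → 0ℚ ℚ.< ε →
             ∃[ N ] (∀ m n → N ℕ.≤ m → N ℕ.≤ n → ℚ.∣ seq m ℚ.- seq n ∣ ℚ.≤ ε)

open ℝ public

infix  4 _≈ᴿ_ _<ᴿ_
infixl 6 _+ᴿ_ _-ᴿ_
infix  8 -ᴿ_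

-- Records rather than functions so that x and y can be inferred.
record _≈ᴿ_ (x y : ℝ) : Set where
  constructor mk≈
  field
    approx : ∀ ε → 0ℚ ℚ.< ε → ∃[ N ] (∀ n → N ℕ.≤ n → ℚ.∣ seq x n ℚ.- seq y n ∣ ℚ.≤ ε)

record _<ᴿ_ (x y : ℝ) : Set where
  constructor mk<
  field
    gap   : ℚ
    0<gap : 0ℚ ℚ.< gap
    below : ∃[ N ] (∀ n → N ℕ.≤ n → seq x n ℚ.+ gap ℚ.≤ seq y n)

open _≈ᴿ_ public
open _<ᴿ_ public

fromℚ : ℚ → ℝ
seq    (fromℚ q) n      = q
cauchy (fromℚ q) ε 0<ε = 0 , λ _ _ _ _ → ∣self-sub∣≤ q 0<ε

_+ᴿ_ : ℝ → ℝ → ℝ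
seq    (x +ᴿ y) n      = seq x n ℚ.+ seq y n
cauchy (x +ᴿ y) ε 0<ε =
  let N , hN = cauchy x (½ ℚ.* ε) (half-pos 0<ε)
      M , hM = cauchy y (½ ℚ.* ε) (half-pos 0<ε)
  in N ⊔ M , λ m n N⊔M≤m N⊔M≤n →
    subst (λ z → ℚ.∣ z ∣ ℚ.≤ ε) (sym (sub-+ (seq x m) (seq y m) (seq x n) (seq y n)))
      (ℚ.≤-trans (ℚ.∣p+q∣≤∣p∣+∣q∣ (seq x m ℚ.- seq x n) (seq y m ℚ.- seq y n))
        (split-≤ (hN m n (ℕ.m⊔n≤o⇒m≤o N M N⊔M≤m) (ℕ.m⊔n≤o⇒m≤o N M N⊔M≤n))
                 (hM m n (ℕ.m⊔n≤o⇒n≤o N M N⊔M≤m) (ℕ.m⊔n≤o⇒n≤o N M N⊔M≤n))))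

private
  neg-sub-neg : ∀ p q → ℚ.∣ ℚ.- p ℚ.- ℚ.- q ∣ ≡ ℚ.∣ p ℚ.- q ∣
  neg-sub-neg p q = trans (cong ℚ.∣_∣ (sym (ℚ.neg-distrib-+ p (ℚ.- q)))) (ℚ.∣-p∣≡∣p∣ (p ℚ.- q))

-ᴿ_ : ℝ → ℝ
seq    (-ᴿ x) n      = ℚ.- seq x n
cauchy (-ᴿ x) ε 0<ε =
  let N , hN = cauchy x ε 0<ε
  in N , λ m n N≤m N≤n → subst (ℚ._≤ ε) (sym (neg-sub-neg (seq x m) (seq x n))) (hN m n N≤m N≤n)

_-ᴿ_ : ℝ → ℝ → ℝ
x -ᴿ y = x +ᴿ -ᴿ y

∣_∣ᴿ : ℝ → ℝ
seq    ∣ x ∣ᴿ n      = ℚ.∣ seq x n ∣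
cauchy ∣ x ∣ᴿ ε 0<ε =
  let N , hN = cauchy x ε 0<ε
  in N , λ m n N≤m N≤n → ℚ.≤-trans (reverse-triangle (seq x m) (seq x n)) (hN m n N≤m N≤n)

private
  ≡⇒≈ᴿ : ∀ {x y} → (∀ n → seq x n ≡ seq y n) → x ≈ᴿ y
  ≡⇒≈ᴿ eq = mk≈ λ ε 0<ε → 0 , λ n _ → ≡⇒∣-∣≤ 0<ε (eq n)

  ≈ᴿ-sym : ∀ {x y} → x ≈ᴿ y → y ≈ᴿ x
  ≈ᴿ-sym {x} {y} x≈y = mk≈ λ ε 0<ε →
    let N , h = approx x≈y ε 0<ε
    in N , λ n N≤n → subst (ℚ._≤ ε) (abs-sub-comm (seq x n) (seq y n)) (h n N≤n)

  ≈ᴿ-trans : ∀ {x y z} → x ≈ᴿ y → y ≈ᴿ z → x ≈ᴿ z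
  ≈ᴿ-trans {x} {y} {z} x≈y y≈z = mk≈ λ ε 0<ε →
    let N , hN = approx x≈y (½ ℚ.* ε) (half-pos 0<ε)
        M , hM = approx y≈z (½ ℚ.* ε) (half-pos 0<ε)
    in N ⊔ M , λ n N⊔M≤n →
      ℚ.≤-trans (triangle (seq x n) (seq y n) (seq z n))
        (split-≤ (hN n (ℕ.m⊔n≤o⇒m≤o N M N⊔M≤n)) (hM n (ℕ.m⊔n≤o⇒n≤o N M N⊔M≤n)))

  +ᴿ-cong : ∀ {x y u v} → x ≈ᴿ y → u ≈ᴿ v → x +ᴿ u ≈ᴿ y +ᴿ v
  +ᴿ-cong {x} {y} {u} {v} x≈y u≈v = mk≈ λ ε 0<ε →
    let N , hN = approx x≈y (½ ℚ.* ε) (half-pos 0<ε)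
        M , hM = approx u≈v (½ ℚ.* ε) (half-pos 0<ε)
    in N ⊔ M , λ n N⊔M≤n →
      subst (λ z → ℚ.∣ z ∣ ℚ.≤ ε) (sym (sub-+ (seq x n) (seq u n) (seq y n) (seq v n)))
        (ℚ.≤-trans (ℚ.∣p+q∣≤∣p∣+∣q∣ (seq x n ℚ.- seq y n) (seq u n ℚ.- seq v n))
          (split-≤ (hN n (ℕ.m⊔n≤o⇒m≤o N M N⊔M≤n)) (hM n (ℕ.m⊔n≤o⇒n≤o N M N⊔M≤n))))

  -ᴿ-cong : ∀ {x y} → x ≈ᴿ y → -ᴿ x ≈ᴿ -ᴿ y
  -ᴿ-cong {x} {y} x≈y = mk≈ λ ε 0<ε →
    let N , h = approx x≈y ε 0<ε
    in N , λ n N≤n → subst (ℚ._≤ ε) (sym (neg-sub-neg (seq x n) (seq y n))) (h n N≤n)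

ℝ-+-abelianGroup : AbelianGroup 0ℓ 0ℓ
ℝ-+-abelianGroup = record
  { Carrier = ℝ
  ; _≈_     = _≈ᴿ_
  ; _∙_     = _+ᴿ_
  ; ε       = fromℚ 0ℚ
  ; _⁻¹     = -ᴿ_
  ; isAbelianGroup = record
    { isGroup = record
      { isMonoid = record
        { isSemigroup = record
          { isMagma = record
            { isEquivalence = record
              { refl  = ≡⇒≈ᴿ (λ _ → refl)
              ; sym   = ≈ᴿ-sym
              ; trans = ≈ᴿ-trans
              }
            ; ∙-cong = +ᴿ-cong
            }
          ; assoc = λ x y z → ≡⇒≈ᴿ (λ n → ℚ.+-assoc (seq x n) (seq y n) (seq z n))
          }
        ; identity = (λ x → ≡⇒≈ᴿ (λ n → ℚ.+-identityˡ (seq x n)))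
                   , (λ x → ≡⇒≈ᴿ (λ n → ℚ.+-identityʳ (seq x n)))
        }
      ; inverse = (λ x → ≡⇒≈ᴿ (λ n → ℚ.+-inverseˡ (seq x n)))
                , (λ x → ≡⇒≈ᴿ (λ n → ℚ.+-inverseʳ (seq x n)))
      ; ⁻¹-cong = -ᴿ-cong
      }
    ; comm = λ x y → ≡⇒≈ᴿ (λ n → ℚ.+-comm (seq x n) (seq y n))
    }
  }

ℝ^-abelianGroup : ℕ → AbelianGroup 0ℓ 0ℓ
ℝ^-abelianGroup n = Pointwise.abelianGroup (Fin n) ℝ-+-abelianGroup

module ℝ^ (n : ℕ) = AbelianGroup (ℝ^-abelianGroup n)

-- Subsets of a setoid are predicates respecting its equality.  For
-- predicativity, unions are indexed by types at the level of the subsets.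
record Topology {c ℓ : Level} (S : Setoid c ℓ) (p t : Level) :
                Set (c ⊔ˡ ℓ ⊔ˡ suc p ⊔ˡ suc t) where
  open Setoid S using (Carrier; _≈_)
  field
    IsOpen          : Pred (Pred Carrier p) t
    open-respects-≈ : ∀ {A} → IsOpen A → A Respects _≈_
    open-respects-≐ : ∀ {A B} → A ≐ B → IsOpen A → IsOpen B
    open-U          : IsOpen (λ x → Lift p (x ∈ U))
    open-∩          : ∀ {A B} → IsOpen A → IsOpen B → IsOpen (A ∩ B)
    open-⋃          : ∀ {I : Set p} {A : I → Pred Carrier p} →
                      (∀ i → IsOpen (A i)) → IsOpen (⋃ I A)

  NeighbourhoodsOf : {a b : Level} → Pred Carrier a →
                     Pred (Pred Carrier b) (c ⊔ˡ suc p ⊔ˡ t ⊔ˡ a ⊔ˡ b)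
  NeighbourhoodsOf A W = ∃[ O ] (IsOpen O × A ⊆ O × O ⊆ W)

  record IsCompact {a : Level} (K : Pred Carrier a) : Set (suc (c ⊔ˡ suc p ⊔ˡ t) ⊔ˡ ℓ ⊔ˡ a) where
    field
      respects-≈     : K Respects _≈_
      finiteSubcover : (𝒰 : Pred (Pred Carrier p) (c ⊔ˡ suc p ⊔ˡ t)) → 𝒰 ⊆ IsOpen →
                       (∀ {x} → x ∈ K → ∃[ V ] (V ∈ 𝒰 × x ∈ V)) →
                       ∃[ Vs ] (All 𝒰 Vs × (∀ {x} → x ∈ K → Any (x ∈_) Vs))

  IsHausdorff : Set (c ⊔ˡ ℓ ⊔ˡ suc p ⊔ˡ t)
  IsHausdorff = ∀ {x y} → ¬ x ≈ y →
    ∃[ V ] ∃[ W ] (IsOpen V × IsOpen W × x ∈ V × y ∈ W × ¬ V ≬ W)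

  IsLocallyCompact : Set (suc (c ⊔ˡ suc p ⊔ˡ t) ⊔ˡ ℓ)
  IsLocallyCompact = ∀ x → ∃[ W ] (IsCompact {p} W × W ∈ NeighbourhoodsOf (x ≈_))

  IsConnected : Set (c ⊔ˡ suc p ⊔ˡ t)
  IsConnected = ∀ {V W} → IsOpen V → IsOpen W → Universal (V ∪ W) →
                Satisfiable V → Satisfiable W → ¬ ¬ V ≬ W

  HasDenseImage : {a : Level} {A : Set a} → (A → Carrier) → Set (c ⊔ˡ suc p ⊔ˡ t ⊔ˡ a)
  HasDenseImage f = ∀ {V} → IsOpen V → Satisfiable V → ∃[ x ] f x ∈ V

module _ {c₁ ℓ₁ c₂ ℓ₂ p t₁ t₂ : Level} {S₁ : Setoid c₁ ℓ₁} {S₂ : Setoid c₂ ℓ₂} where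
  private
    module S₁ = Setoid S₁
    module S₂ = Setoid S₂

  IsContinuous : Topology S₁ p t₁ → Topology S₂ p t₂ → (S₁.Carrier → S₂.Carrier) →
                 Set (c₂ ⊔ˡ suc p ⊔ˡ t₁ ⊔ˡ t₂)
  IsContinuous T₁ T₂ f = ∀ {V} → Topology.IsOpen T₂ V → Topology.IsOpen T₁ (f ⊢ V)

  productTopology : Topology S₁ p t₁ → Topology S₂ p t₂ →
                    Topology (×-setoid S₁ S₂) p (c₁ ⊔ˡ c₂ ⊔ˡ suc p ⊔ˡ t₁ ⊔ˡ t₂)
  productTopology T₁ T₂ = record
    { IsOpen = λ A → ∀ {x y} → (x , y) ∈ A →
        ∃[ V ] ∃[ W ] (T₁.IsOpen V × T₂.IsOpen W × x ∈ V × y ∈ W ×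
                       (∀ {x′ y′} → x′ ∈ V → y′ ∈ W → (x′ , y′) ∈ A))
    ; open-respects-≈ = λ A-open (x≈x′ , y≈y′) xy∈A →
        let _ , _ , V-open , W-open , x∈V , y∈W , sub = A-open xy∈A
        in sub (T₁.open-respects-≈ V-open x≈x′ x∈V) (T₂.open-respects-≈ W-open y≈y′ y∈W)
    ; open-respects-≐ = λ (A⊆B , B⊆A) A-open xy∈B →
        let V , W , V-open , W-open , x∈V , y∈W , sub = A-open (B⊆A xy∈B)
        in V , W , V-open , W-open , x∈V , y∈W , λ x′∈V y′∈W → A⊆B (sub x′∈V y′∈W)
    ; open-U = λ _ → _ , _ , T₁.open-U , T₂.open-U , lift tt , lift tt , λ _ _ → lift tt
    ; open-∩ = λ A-open B-open (xy∈A , xy∈B) →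
        let _ , _ , V-open  , W-open  , x∈V  , y∈W  , sub  = A-open xy∈A
            _ , _ , V′-open , W′-open , x∈V′ , y∈W′ , sub′ = B-open xy∈B
        in _ , _ , T₁.open-∩ V-open V′-open , T₂.open-∩ W-open W′-open
             , (x∈V , x∈V′) , (y∈W , y∈W′)
             , λ (v , v′) (w , w′) → sub v w , sub′ v′ w′
    ; open-⋃ = λ A-open (i , xy∈Ai) →
        let V , W , V-open , W-open , x∈V , y∈W , sub = A-open i xy∈Ai
        in V , W , V-open , W-open , x∈V , y∈W , λ x′∈V y′∈W → i , sub x′∈V y′∈W
    }
    where
    module T₁ = Topology T₁
    module T₂ = Topology T₂

-- Balls of the supremum norm, which generate the usual topology of ℝⁿ.
Ball : {n : ℕ} → ℝ^.Carrier n → ℚ → Pred (ℝ^.Carrier n) 0ℓ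
Ball x ε y = ∀ i → ∣ x i -ᴿ y i ∣ᴿ <ᴿ fromℚ ε

private
  ≈⇒Ball : ∀ {n x y ε} → 0ℚ ℚ.< ε → ℝ^._≈_ n x y → y ∈ Ball {n} x ε
  ≈⇒Ball {ε = ε} 0<ε x≈y i =
    let N , h = approx (x≈y i) (½ ℚ.* ε) (half-pos 0<ε)
    in mk< (½ ℚ.* ε) (half-pos 0<ε) (N , λ n N≤n → split-≤ (h n N≤n) ℚ.≤-refl)

  Ball-mono : ∀ {n x ε ε′} → ε ℚ.≤ ε′ → Ball {n} x ε ⊆ Ball {n} x ε′
  Ball-mono ε≤ε′ y∈ i =
    let N , h = below (y∈ i)
    in mk< (gap (y∈ i)) (0<gap (y∈ i)) (N , λ n N≤n → ℚ.≤-trans (h n N≤n) ε≤ε′)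

  ⊓-pos : ∀ {ε ε′} → 0ℚ ℚ.< ε → 0ℚ ℚ.< ε′ → 0ℚ ℚ.< ε ℚ.⊓ ε′
  ⊓-pos {ε} {ε′} 0<ε 0<ε′ with ℚ.⊓-sel ε ε′
  ... | inj₁ eq = subst (0ℚ ℚ.<_) (sym eq) 0<ε
  ... | inj₂ eq = subst (0ℚ ℚ.<_) (sym eq) 0<ε′

ℝ^-topology : (n : ℕ) (p : Level) → Topology (ℝ^.setoid n) p p
ℝ^-topology n p = record
  { IsOpen = λ A → ∀ {x} → x ∈ A → ∃[ ε ] (0ℚ ℚ.< ε × Ball {n} x ε ⊆ A)
  ; open-respects-≈ = λ A-open x≈y x∈A →
      let _ , 0<ε , sub = A-open x∈A in sub (≈⇒Ball {n} 0<ε x≈y)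
  ; open-respects-≐ = λ (A⊆B , B⊆A) A-open x∈B →
      let ε , 0<ε , sub = A-open (B⊆A x∈B) in ε , 0<ε , λ y∈ → A⊆B (sub y∈)
  ; open-U = λ _ → ℚ.1ℚ , ℚ.positive⁻¹ ℚ.1ℚ , λ _ → lift tt
  ; open-∩ = λ A-open B-open (x∈A , x∈B) →
      let ε  , 0<ε  , sub  = A-open x∈A
          ε′ , 0<ε′ , sub′ = B-open x∈B
      in ε ℚ.⊓ ε′ , ⊓-pos 0<ε 0<ε′
           , λ y∈ → sub (Ball-mono {n} (ℚ.p⊓q≤p ε ε′) y∈)
                  , sub′ (Ball-mono {n} (ℚ.p⊓q≤q ε ε′) y∈)
  ; open-⋃ = λ A-open (i , x∈Ai) →
      let ε , 0<ε , sub = A-open i x∈Ai in ε , 0<ε , λ y∈ → i , sub y∈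
  }

module ℝ^ᵗ (n : ℕ) (p : Level) = Topology (ℝ^-topology n p)

record TopologicalGroup (a t : Level) : Set (suc (a ⊔ˡ t)) where
  field
    group    : Group a a
  open Group group
  field
    topology       : Topology setoid a t
    ∙-continuous   : IsContinuous (productTopology topology topology) topology (λ (x , y) → x ∙ y)
    ⁻¹-continuous  : IsContinuous topology topology _⁻¹
  open Topology topology public

record IsLocallyCompactGroup {a t : Level} (L : TopologicalGroup a t) : Set (suc (suc a ⊔ˡ t)) where
  open TopologicalGroup L
  field
    hausdorff      : IsHausdorff
    locallyCompact : IsLocallyCompact

zpow : {c ℓ : Level} (G : Group c ℓ) → Group.Carrier G → ℤ → Group.Carrier G
zpow G x (+ k)      = multiple (Group.rawMonoid G) k x
zpow G x (-[1+ k ]) = Group._⁻¹ G (multiple (Group.rawMonoid G) (ℕ.suc k) x)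

module _ {c ℓ : Level} (G : Group c ℓ) where
  open Group G

  infixl 7 _·_
  infix  8 _⁻¹ˢ

  _·_ : {a b : Level} → Pred Carrier a → Pred Carrier b → Pred Carrier (c ⊔ˡ ℓ ⊔ˡ a ⊔ˡ b)
  (A · B) x = ∃[ a ] ∃[ b ] (a ∈ A × b ∈ B × x ≈ a ∙ b)

  _⁻¹ˢ : {a : Level} → Pred Carrier a → Pred Carrier a
  A ⁻¹ˢ = _⁻¹ ⊢ A

  -- A ⊆ ⋃ B c, with c ranging over a finite list.
  CoveredByRightTranslatesOf : {a b : Level} → Pred Carrier a → Pred Carrier b →
                               Set (c ⊔ˡ ℓ ⊔ˡ a ⊔ˡ b)
  CoveredByRightTranslatesOf A B =
    ∃[ cs ] (∀ {x} → x ∈ A → Any (λ c → x ∈ B · (c ≈_)) cs)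

  Commensurable : {a b : Level} → Pred Carrier a → Pred Carrier b → Set (c ⊔ˡ ℓ ⊔ˡ a ⊔ˡ b)
  Commensurable A B = CoveredByRightTranslatesOf A B × CoveredByRightTranslatesOf B A

  record IsApproximateSubgroup {p : Level} (Λ : Pred Carrier p) : Set (c ⊔ˡ ℓ ⊔ˡ p) where
    field
      respects-≈    : Λ Respects _≈_
      ε∈Λ           : ε ∈ Λ
      symmetric     : Λ ≐ Λ ⁻¹ˢ
      commensurable : Commensurable Λ (Λ · Λ)

  commensurabilityClass : {p q : Level} → Pred Carrier q →
                          Pred (Pred Carrier p) (c ⊔ˡ ℓ ⊔ˡ p ⊔ˡ q)
  commensurabilityClass A Λ = IsApproximateSubgroup Λ × Commensurable Λ A

  IsCommensurabilityClass : {p w : Level} → Pred (Pred Carrier p) w → Set (c ⊔ˡ ℓ ⊔ˡ suc p ⊔ˡ w)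
  IsCommensurabilityClass {p} ω = ∃[ Λ ] (IsApproximateSubgroup {p} Λ × ω ≐ commensurabilityClass Λ)

module _ {c ℓ : Level} (G : Group c ℓ) {n : ℕ} (g : Group.Carrier G → ℝ^.Carrier n) where
  open Group G
  private module V = ℝ^ n

  defect : Carrier → Carrier → V.Carrier
  defect x y = (g (x ∙ y) V.- g x) V.- g y

  record IsHomogeneousQuasimorphism : Set (c ⊔ˡ ℓ) where
    field
      g-cong        : ∀ {x y} → x ≈ y → g x V.≈ g y
      boundedDefect : ∃[ B ] (∀ x y i → ∣ defect x y i ∣ᴿ <ᴿ fromℚ B)
      homogeneous   : ∀ x k → g (zpow G x k) V.≈ zpow V.group (g x) k

  record IsCompactErrorSet {p : Level} (K : Pred V.Carrier p) : Set (c ⊔ˡ suc (suc p)) where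
    field
      compact   : ℝ^ᵗ.IsCompact n p K
      symmetric : K ≐ V._⁻¹ ⊢ K
      defect∈K  : ∀ x y → defect x y ∈ K

  -- "ω = χ(g)".  As χ(g) does not depend on K and W, it is given as a
  -- relation: ω is the class obtained from some admissible K and W.
  Isχ-quasimorphism : {p w : Level} → Pred (Pred Carrier p) w → Set (c ⊔ˡ ℓ ⊔ˡ suc (suc p) ⊔ˡ w)
  Isχ-quasimorphism {p} ω =
    ∃[ K ] ∃[ W ] (IsCompactErrorSet {p} K ×
                   ℝ^ᵗ.IsCompact n p {p} W × W ∈ ℝ^ᵗ.NeighbourhoodsOf n p K ×
                   ω ≐ commensurabilityClass G (_·_ G (g ⊢ W) (_⁻¹ˢ G (g ⊢ W))))

module _ {c ℓ a t : Level} (G : Group c ℓ) (L : TopologicalGroup a t)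
         (f : Group.Carrier G → Group.Carrier (TopologicalGroup.group L)) where
  open Group G using (Carrier)
  private module L = TopologicalGroup L

  -- "ω = χ(f)", as a relation for the same reason.
  Isχ-homomorphism : {p w : Level} → Pred (Pred Carrier p) w →
                     Set (c ⊔ˡ ℓ ⊔ˡ suc (suc a ⊔ˡ t) ⊔ˡ suc p ⊔ˡ w)
  Isχ-homomorphism ω =
    ∃[ W ] (L.IsCompact {a} W × W ∈ L.NeighbourhoodsOf (Lε.ε Lε.≈_) ×
            ω ≐ commensurabilityClass G (_·_ G (f ⊢ W) (_⁻¹ˢ G (f ⊢ W))))
    where module Lε = Group L.group

{-# OPTIONS --safe #-}

-- Let φ be a coordinate of g, with defect bounded by D.  As g is conjugation
-- invariant, commutators lie in Y = g⁻¹(W), hence in finitely many right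
-- translates of ZZ⁻¹ with Z = f⁻¹(U), and φ is bounded on ZZ⁻¹.  Continuity of
-- the group operations of L and compactness of U then give, for every δ > 0, a
-- finite colouring of the commutators such that |φ(uv⁻¹)| < δ for u, v of the
-- same colour; here conjugation invariance is what makes left translates and
-- right translates interchangeable.  With N colours, pigeonhole on the [bᵏ, a],
-- k ≤ N, and the identity
-- [bʲ, a] [bⁱ, a]⁻¹ = bⁱ [bʲ⁻ⁱ, a] b⁻ⁱ yield 1 ≤ m ≤ N with |φ([bᵐ, a])| < δ.
-- Since [bᵏ⁺¹, a] = (b [bᵏ, a] b⁻¹) [b, a], it follows that
-- m |φ([b, a])| ≤ δ + (m - 1) D.  Finally (xy)³ = (x w x⁻¹) x³ y³ for the
-- commutator w = [yxy, xy⁻¹], so 3 |φ(xy) - φ(x) - φ(y)| ≤ 2 D + |φ(w)|.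
-- Together these improve the bound D by a fixed amount as long as D is not
-- small compared to δ, so the defect vanishes.
module Submission where

open import Defs
open import Algebra.Bundles using (AbelianGroup; Group)
open import Algebra.Definitions.RawMonoid using () renaming (_×_ to multiple)
open import Algebra.Morphism.Structures using (IsGroupHomomorphism)
import Algebra.Properties.CommutativeMonoid.Mult as CommutativeMonoidMult
import Algebra.Properties.Group as GroupProperties
import Algebra.Properties.Monoid.Mult as MonoidMult
open import Data.Bool.Base using (Bool; true; false; not)
import Data.Bool.Properties as Bool
open import Data.Fin.Base as Fin using (Fin; toℕ)
import Data.Fin.Properties as Fin
open import Data.Integer.Base as ℤ using (+_; -[1+_])
import Data.Integer.Properties as ℤ
open import Data.List.Base as List using (List; []; _∷_)
open import Data.List.Relation.Unary.All using (All; []; _∷_)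
open import Data.List.Relation.Unary.Any using (Any; here; there; index)
open import Data.List.Relation.Unary.Any.Properties using (lookup-index)
open import Data.Nat.Base as ℕ using (ℕ; zero; suc)
import Data.Nat.Properties as ℕ
open import Data.Product.Base using (Σ-syntax; ∃-syntax; _×_; _,_; proj₁; proj₂)
open import Data.Rational.Base as ℚ using (ℚ; 0ℚ; 1ℚ; Positive)
import Data.Rational.Properties as ℚ
open import Data.Rational.Solver using (module +-*-Solver)
import Data.Rational.Unnormalised.Base as ℚᵘ
import Data.Rational.Unnormalised.Properties as ℚᵘ
open import Data.Vec.Base using (Vec; []; _∷_; lookup)
open import Level using (Level; Lift; lift; _⊔_) renaming (suc to lsuc)
open import Relation.Binary.Definitions using (_Respects_)
open import Relation.Binary.PropositionalEquality
  using (_≡_; refl; sym; trans; cong; cong₂; subst; subst₂)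
open import Relation.Nullary.Decidable using (yes; no)
open import Relation.Unary using (Pred; _∈_; _⊆_; _⊢_)

open +-*-Solver using (Polynomial; solve; _:=_; _:+_; _:*_; _:-_; :-_; con)

private
  module ℝᴳ = AbelianGroup ℝ-+-abelianGroup

open CommutativeMonoidMult ℝᴳ.commutativeMonoid using ()
  renaming (_×_ to infixr 8 _×ᴿ_; ×-congʳ to ×ᴿ-congʳ; ×-distrib-+ to ×ᴿ-distrib-+)

-- Real numbers bounded by a rational

ι : ℕ → ℚ
ι k = + k ℚ./ 1

toℚᵘ-ι : ∀ k → ℚ.toℚᵘ (ι k) ℚᵘ.≃ ℚᵘ.mkℚᵘ (+ k) 0
toℚᵘ-ι k = ℚ.toℚᵘ-fromℚᵘ (ℚᵘ.mkℚᵘ (+ k) 0)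

ι-suc : ∀ k → ι (suc k) ≡ 1ℚ ℚ.+ ι k
ι-suc k = ℚ.toℚᵘ-injective (ℚᵘ.≃-trans (toℚᵘ-ι (suc k)) (ℚᵘ.≃-sym
  (ℚᵘ.≃-trans (ℚ.toℚᵘ-homo-+ 1ℚ (ι k))
    (ℚᵘ.≃-trans (ℚᵘ.+-congʳ (ℚ.toℚᵘ 1ℚ) (toℚᵘ-ι k))
      (ℚᵘ.*≡* (cong (λ z → (+ 1 ℤ.+ z) ℤ.* + 1) (ℤ.*-identityʳ (+ k))))))))

0≤ι : ∀ k → 0ℚ ℚ.≤ ι k
0≤ι k = ℚ.nonNegative⁻¹ (ι k) {{ℚ.normalize-nonNeg k 1}}

ι-pos : ∀ k → Positive (ι (suc k))
ι-pos k = ℚ.normalize-pos (suc k) 1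

ι-mono : ∀ {k l} → k ℕ.≤ l → ι k ℚ.≤ ι l
ι-mono {l = l} ℕ.z≤n = 0≤ι l
ι-mono (ℕ.s≤s {k} {l} k≤l) =
  subst₂ ℚ._≤_ (sym (ι-suc k)) (sym (ι-suc l)) (ℚ.+-monoʳ-≤ 1ℚ (ι-mono k≤l))

-- The absolute value of the numerator serves, as the denominator is at least 1.
≤ι : ∀ q → ∃[ k ] q ℚ.≤ ι k
≤ι (ℚ.mkℚ i d _) = ℤ.∣ i ∣ , ℚ.toℚᵘ-cancel-≤
  (ℚᵘ.≤-respʳ-≃ (ℚᵘ.≃-sym (toℚᵘ-ι ℤ.∣ i ∣))
    (ℚᵘ.*≤* (subst₂ ℤ._≤_ (sym (ℤ.*-identityʳ i)) (ℤ.pos-* ℤ.∣ i ∣ (suc d))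
      (ℤ.≤-trans (i≤∣i∣ i) (ℤ.+≤+ (ℕ.m≤m*n ℤ.∣ i ∣ (suc d)))))))
  where
  i≤∣i∣ : ∀ i → i ℤ.≤ + ℤ.∣ i ∣
  i≤∣i∣ (+ n)    = ℤ.≤-refl
  i≤∣i∣ -[1+ n ] = ℤ.-≤+

-- The factor is `suc k` rather than `k` so that `≺-×-cancel` can divide by it later.
archimedean : ∀ q {ε} → 0ℚ ℚ.< ε → ∃[ k ] q ℚ.≤ ι (suc k) ℚ.* ε
archimedean q {ε} 0<ε =
  let k , h = ≤ι (q ℚ.* ℚ.1/ ε)
  in k , ℚ.≤-trans
       (ℚ.≤-reflexive (sym (trans (ℚ.*-assoc q (ℚ.1/ ε) ε)
         (trans (cong (q ℚ.*_) (ℚ.*-inverseˡ ε)) (ℚ.*-identityʳ q)))))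
       (ℚ.*-monoʳ-≤-nonNeg ε (ℚ.≤-trans h (ι-mono (ℕ.n≤1+n k))))
  where
  instance
    _ = ℚ.positive 0<ε
    _ = ℚ.pos⇒nonZero ε
    _ = ℚ.pos⇒nonNeg ε

fraction-pos : ∀ k {ε} → 0ℚ ℚ.< ε → ∃[ δ ] (0ℚ ℚ.< δ × ι (suc k) ℚ.* δ ≡ ε)
fraction-pos k {ε} 0<ε =
  ℚ.1/ ι (suc k) ℚ.* ε ,
  subst (ℚ._< ℚ.1/ ι (suc k) ℚ.* ε) (ℚ.*-zeroʳ (ℚ.1/ ι (suc k)))
    (ℚ.*-monoʳ-<-pos (ℚ.1/ ι (suc k)) 0<ε) ,
  trans (sym (ℚ.*-assoc (ι (suc k)) (ℚ.1/ ι (suc k)) ε))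
    (trans (cong (ℚ._* ε) (ℚ.*-inverseʳ (ι (suc k)))) (ℚ.*-identityˡ ε))
  where
  instance
    _ = ι-pos k
    _ = ℚ.pos⇒nonZero (ι (suc k))
    _ = ℚ.1/pos⇒pos (ι (suc k))

infix 4 _≺_
_≺_ : ℝ → ℚ → Set
x ≺ q = ∣ x ∣ᴿ <ᴿ fromℚ q

≺-mono : ∀ {x p q} → p ℚ.≤ q → x ≺ p → x ≺ q
≺-mono p≤q (mk< γ 0<γ (N , h)) = mk< γ 0<γ (N , λ n N≤n → ℚ.≤-trans (h n N≤n) p≤q)

-- Half of the gap absorbs the distance between the two sequences, the other half is the new gap.
≺-resp-≈ : ∀ {x y q} → x ≈ᴿ y → x ≺ q → y ≺ q
≺-resp-≈ {x} {y} {q} x≈y (mk< γ 0<γ (N , h)) =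
  let δ , 0<δ , 2δ≡γ = fraction-pos 1 0<γ
      M , h′ = approx x≈y δ 0<δ
  in mk< δ 0<δ (N ℕ.⊔ M , λ n N⊔M≤n → ℚ.≤-trans
       (ℚ.+-monoˡ-≤ δ (ℚ.≤-trans
         (ℚ.≤-reflexive (cong ℚ.∣_∣ (solve 2 (λ a b → b := a :- (a :- b)) refl (seq x n) (seq y n))))
         (ℚ.≤-trans (ℚ.∣p-q∣≤∣p∣+∣q∣ (seq x n) (seq x n ℚ.- seq y n))
           (ℚ.+-monoʳ-≤ ℚ.∣ seq x n ∣ (h′ n (ℕ.m⊔n≤o⇒n≤o N M N⊔M≤n))))))
       (ℚ.≤-trans (ℚ.≤-reflexive (trans (double ℚ.∣ seq x n ∣ δ) (cong (ℚ.∣ seq x n ∣ ℚ.+_) 2δ≡γ)))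
         (h n (ℕ.m⊔n≤o⇒m≤o N M N⊔M≤n))))
  where
  double : ∀ p δ → (p ℚ.+ δ) ℚ.+ δ ≡ p ℚ.+ ι 2 ℚ.* δ
  double = solve 2 (λ p δ → (p :+ δ) :+ δ := p :+ con (ι 2) :* δ) refl

≺-+ : ∀ {x y p q} → x ≺ p → y ≺ q → x +ᴿ y ≺ p ℚ.+ q
≺-+ {x} {y} (mk< γ 0<γ (N , h)) (mk< γ′ 0<γ′ (M , h′)) =
  mk< (γ ℚ.+ γ′) (ℚ.+-mono-< 0<γ 0<γ′) (N ℕ.⊔ M , λ n N⊔M≤n → ℚ.≤-trans
    (ℚ.+-monoˡ-≤ (γ ℚ.+ γ′) (ℚ.∣p+q∣≤∣p∣+∣q∣ (seq x n) (seq y n)))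
    (ℚ.≤-trans (ℚ.≤-reflexive (interchange ℚ.∣ seq x n ∣ ℚ.∣ seq y n ∣ γ γ′))
      (ℚ.+-mono-≤ (h n (ℕ.m⊔n≤o⇒m≤o N M N⊔M≤n)) (h′ n (ℕ.m⊔n≤o⇒n≤o N M N⊔M≤n)))))
  where
  interchange : ∀ a b c d → (a ℚ.+ b) ℚ.+ (c ℚ.+ d) ≡ (a ℚ.+ c) ℚ.+ (b ℚ.+ d)
  interchange = solve 4 (λ a b c d → (a :+ b) :+ (c :+ d) := (a :+ c) :+ (b :+ d)) refl

≺-neg : ∀ {x q} → x ≺ q → -ᴿ x ≺ q
≺-neg {x} (mk< γ 0<γ (N , h)) = mk< γ 0<γ (N , λ n N≤n →
  subst (λ z → z ℚ.+ γ ℚ.≤ _) (sym (ℚ.∣-p∣≡∣p∣ (seq x n))) (h n N≤n))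

≺-- : ∀ {x y p q} → x ≺ p → y ≺ q → x -ᴿ y ≺ p ℚ.+ q
≺-- {y = y} x≺p y≺q = ≺-+ x≺p (≺-neg {y} y≺q)

bounded : ∀ x → ∃[ q ] x ≺ q
bounded x =
  let N , h = cauchy x 1ℚ (ℚ.positive⁻¹ 1ℚ)
  -- From `N` on, every term is within 1 of `seq x N`; the second 1 is the gap of the strict
  -- inequality.
  in (1ℚ ℚ.+ ℚ.∣ seq x N ∣) ℚ.+ 1ℚ , mk< 1ℚ (ℚ.positive⁻¹ 1ℚ) (N , λ n N≤n →
       ℚ.+-monoˡ-≤ 1ℚ (ℚ.≤-trans
         (ℚ.≤-reflexive (cong ℚ.∣_∣ (solve 2 (λ a b → a := (a :- b) :+ b) refl (seq x n) (seq x N))))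
         (ℚ.≤-trans (ℚ.∣p+q∣≤∣p∣+∣q∣ (seq x n ℚ.- seq x N) (seq x N))
           (ℚ.+-monoˡ-≤ ℚ.∣ seq x N ∣ (h n N N≤n ℕ.≤-refl)))))

≺⇒≈0 : ∀ {x} → (∀ q → 0ℚ ℚ.< q → x ≺ q) → x ≈ᴿ fromℚ 0ℚ
≺⇒≈0 {x} h = mk≈ λ ε 0<ε →
  let mk< γ 0<γ (N , h′) = h ε 0<ε
  in N , λ n N≤n → ℚ.≤-trans
       (ℚ.≤-reflexive (cong ℚ.∣_∣ (ℚ.+-identityʳ (seq x n))))
       (ℚ.≤-trans (ℚ.≤-reflexive (sym (ℚ.+-identityʳ ℚ.∣ seq x n ∣)))
         (ℚ.≤-trans (ℚ.+-monoʳ-≤ ℚ.∣ seq x n ∣ (ℚ.<⇒≤ 0<γ)) (h′ n N≤n)))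

seq-× : ∀ k x n → seq (k ×ᴿ x) n ≡ ι k ℚ.* seq x n
seq-× zero    x n = sym (ℚ.*-zeroˡ (seq x n))
seq-× (suc k) x n = trans (cong (seq x n ℚ.+_) (seq-× k x n))
  (trans (solve 2 (λ a b → b :+ a :* b := (con 1ℚ :+ a) :* b) refl (ι k) (seq x n))
    (cong (ℚ._* seq x n) (sym (ι-suc k))))

∣seq-×∣ : ∀ k x n → ℚ.∣ seq (k ×ᴿ x) n ∣ ≡ ι k ℚ.* ℚ.∣ seq x n ∣
∣seq-×∣ k x n = trans (cong ℚ.∣_∣ (seq-× k x n))
  (trans (ℚ.∣p*q∣≡∣p∣*∣q∣ (ι k) (seq x n)) (cong (ℚ._* ℚ.∣ seq x n ∣) (ℚ.0≤p⇒∣p∣≡p (0≤ι k))))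

≺-× : ∀ k {x q} → x ≺ q → suc k ×ᴿ x ≺ ι (suc k) ℚ.* q
≺-× k {x} {q} (mk< γ 0<γ (N , h)) =
  mk< (ι (suc k) ℚ.* γ)
    (subst (ℚ._< ι (suc k) ℚ.* γ) (ℚ.*-zeroʳ (ι (suc k))) (ℚ.*-monoʳ-<-pos (ι (suc k)) 0<γ))
    (N , λ n N≤n → subst (ℚ._≤ ι (suc k) ℚ.* q)
      (trans (ℚ.*-distribˡ-+ (ι (suc k)) ℚ.∣ seq x n ∣ γ)
        (cong (ℚ._+ ι (suc k) ℚ.* γ) (sym (∣seq-×∣ (suc k) x n))))
      (ℚ.*-monoˡ-≤-nonNeg (ι (suc k)) (h n N≤n)))
  where
  instance
    _ = ι-pos k
    _ = ℚ.pos⇒nonNeg (ι (suc k))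

≺-×-cancel : ∀ k {x q} → suc k ×ᴿ x ≺ ι (suc k) ℚ.* q → x ≺ q
≺-×-cancel k {x} {q} (mk< γ 0<γ (N , h)) =
  let δ , 0<δ , kδ≡γ = fraction-pos k 0<γ
  in mk< δ 0<δ (N , λ n N≤n → ℚ.*-cancelˡ-≤-pos (ι (suc k)) {{ι-pos k}}
       (subst (ℚ._≤ ι (suc k) ℚ.* q)
         (trans (cong₂ ℚ._+_ (∣seq-×∣ (suc k) x n) (sym kδ≡γ))
           (sym (ℚ.*-distribˡ-+ (ι (suc k)) ℚ.∣ seq x n ∣ δ)))
         (h n N≤n)))

-- As `q` does not depend on `k`, division gives bounds `q / (k + 1)`, which tend to 0. This turns
-- bounded errors of homogeneous maps into equalities.
×-bounded⇒≈0 : ∀ {x q} → (∀ k → suc k ×ᴿ x ≺ q) → x ≈ᴿ fromℚ 0ℚ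
×-bounded⇒≈0 {x} {q} h = ≺⇒≈0 λ ε 0<ε →
  let k , q≤kε = archimedean q 0<ε in ≺-×-cancel k (≺-mono {suc k ×ᴿ x} q≤kε (h k))

-- Reduces an equation in ℝ that follows from u ≈ v to a pointwise identity in ℚ.
≈-from : ∀ {u v x y} → u ≈ᴿ v → (∀ n → seq x n ℚ.- seq y n ≡ seq u n ℚ.- seq v n) → x ≈ᴿ y
≈-from u≈v eq = mk≈ λ ε 0<ε →
  let N , h = approx u≈v ε 0<ε
  in N , λ n N≤n → subst (λ z → ℚ.∣ z ∣ ℚ.≤ ε) (sym (eq n)) (h n N≤n)

×ᴿ-sub : ∀ k x y → k ×ᴿ (x -ᴿ y) ≈ᴿ k ×ᴿ x -ᴿ k ×ᴿ y
×ᴿ-sub k x y = ≈-from (ℝᴳ.refl {x}) λ n →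
  trans (cong₂ ℚ._-_ (seq-× k (x -ᴿ y) n) (cong₂ ℚ._-_ (seq-× k x n) (seq-× k y n)))
    (solve 3 (λ k x y → k :* (x :- y) :- (k :* x :- k :* y) := x :- x) refl (ι k) (seq x n) (seq y n))

≈0⇒≈ : ∀ {x y} → x -ᴿ y ≈ᴿ fromℚ 0ℚ → x ≈ᴿ y
≈0⇒≈ {x} {y} h = ≈-from h λ n → sym (ℚ.+-identityʳ (seq x n ℚ.- seq y n))

-- Half of the gap lowers the bound and half stays as gap. This makes the slabs in `compact⇒bounded`
-- open.
≺-shrink : ∀ {x q} → x ≺ q → ∃[ δ ] (0ℚ ℚ.< δ × x ≺ q ℚ.- δ)
≺-shrink {x} {q} (mk< γ 0<γ (N , h)) =
  let δ , 0<δ , 2δ≡γ = fraction-pos 1 0<γ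
  in δ , 0<δ , mk< δ 0<δ (N , λ n N≤n → ℚ.≤-trans
       (ℚ.≤-reflexive (trans
         (solve 2 (λ p δ → p :+ δ := (p :+ con (ι 2) :* δ) :- δ) refl ℚ.∣ seq x n ∣ δ)
         (cong (λ z → (ℚ.∣ seq x n ∣ ℚ.+ z) ℚ.- δ) 2δ≡γ)))
       (ℚ.+-monoˡ-≤ (ℚ.- δ) (h n N≤n)))

-- Deciding equations in groups by free reduction

infixl 7 _⊙_
infix 8 _⊖
data Word (n : ℕ) : Set where
  one : Word n
  var : Fin n → Word n
  _⊙_ : Word n → Word n → Word n
  _⊖  : Word n → Word n

-- The flag true marks the inverse of a generator.
Letter : ℕ → Set
Letter n = Fin n × Bool

push : ∀ {n} → Letter n → List (Letter n) → List (Letter n)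
push l [] = l ∷ []
push (i , s) ((j , t) ∷ ls) with i Fin.≟ j | t Bool.≟ not s
... | yes _ | yes _ = ls
... | _     | _     = (i , s) ∷ (j , t) ∷ ls

-- The flag tells whether the word is to be inverted, and the list holds the reduced letters
-- standing to its right. Inverses thus travel down to the letters, and each letter can cancel only
-- against the head of the list.
reduce : ∀ {n} → Word n → Bool → List (Letter n) → List (Letter n)
reduce one     s     ls = ls
reduce (var i) s     ls = push (i , s) ls
reduce (u ⊙ v) false ls = reduce u false (reduce v false ls)
reduce (u ⊙ v) true  ls = reduce v true (reduce u true ls)
reduce (u ⊖)   s     ls = reduce u (not s) ls

module FreeReduction {c ℓ} (G : Group c ℓ) where
  open Group G renaming (refl to ≈-refl; sym to ≈-sym; trans to ≈-trans)
  open GroupProperties G using (⁻¹-involutive; ⁻¹-anti-homo-∙; ε⁻¹≈ε)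

  module _ {n : ℕ} (ρ : Vec Carrier n) where
    infix 9 _^±_
    _^±_ : Carrier → Bool → Carrier
    x ^± false = x
    x ^± true  = x ⁻¹

    ⟦_⟧ : Word n → Carrier
    ⟦ one ⟧   = ε
    ⟦ var i ⟧ = lookup ρ i
    ⟦ u ⊙ v ⟧ = ⟦ u ⟧ ∙ ⟦ v ⟧
    ⟦ u ⊖ ⟧   = ⟦ u ⟧ ⁻¹

    ⟦_⟧ˡ : List (Letter n) → Carrier
    ⟦ [] ⟧ˡ           = ε
    ⟦ (i , s) ∷ ls ⟧ˡ = lookup ρ i ^± s ∙ ⟦ ls ⟧ˡ

    ^±-cancel : ∀ x s y → x ^± s ∙ (x ^± not s ∙ y) ≈ y
    ^±-cancel x false y = ≈-trans (≈-sym (assoc x (x ⁻¹) y)) (≈-trans (∙-congʳ (inverseʳ x)) (identityˡ y))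
    ^±-cancel x true  y = ≈-trans (≈-sym (assoc (x ⁻¹) x y)) (≈-trans (∙-congʳ (inverseˡ x)) (identityˡ y))

    ^±-not : ∀ x s → (x ⁻¹) ^± s ≈ x ^± not s
    ^±-not x false = ≈-refl
    ^±-not x true  = ⁻¹-involutive x

    push-correct : ∀ l ls → ⟦ push l ls ⟧ˡ ≈ lookup ρ (proj₁ l) ^± proj₂ l ∙ ⟦ ls ⟧ˡ
    push-correct l [] = ≈-refl
    push-correct (i , s) ((j , t) ∷ ls) with i Fin.≟ j | t Bool.≟ not s
    ... | yes refl | yes refl = ≈-sym (^±-cancel (lookup ρ i) s ⟦ ls ⟧ˡ)
    ... | yes _    | no _     = ≈-refl
    ... | no _     | yes _    = ≈-refl
    ... | no _     | no _     = ≈-refl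

    reduce-correct : ∀ u s ls → ⟦ reduce u s ls ⟧ˡ ≈ ⟦ u ⟧ ^± s ∙ ⟦ ls ⟧ˡ
    reduce-correct one false ls = ≈-sym (identityˡ ⟦ ls ⟧ˡ)
    reduce-correct one true  ls = ≈-sym (≈-trans (∙-congʳ ε⁻¹≈ε) (identityˡ ⟦ ls ⟧ˡ))
    reduce-correct (var i) s ls = push-correct (i , s) ls
    reduce-correct (u ⊙ v) false ls =
      ≈-trans (reduce-correct u false (reduce v false ls))
        (≈-trans (∙-congˡ (reduce-correct v false ls)) (≈-sym (assoc _ _ _)))
    reduce-correct (u ⊙ v) true ls =
      ≈-trans (reduce-correct v true (reduce u true ls))
        (≈-trans (∙-congˡ (reduce-correct u true ls))
          (≈-trans (≈-sym (assoc _ _ _)) (∙-congʳ (≈-sym (⁻¹-anti-homo-∙ ⟦ u ⟧ ⟦ v ⟧)))))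
    reduce-correct (u ⊖) s ls =
      ≈-trans (reduce-correct u (not s) ls) (∙-congʳ (≈-sym (^±-not ⟦ u ⟧ s)))

    -- Each word has the value of its reduced list of letters. For concrete words the hypothesis
    -- holds by computation, so `refl` proves it.
    by-reduction : ∀ u v → reduce u false [] ≡ reduce v false [] → ⟦ u ⟧ ≈ ⟦ v ⟧
    by-reduction u v eq =
      ≈-trans (≈-sym (≈-trans (reduce-correct u false []) (identityʳ ⟦ u ⟧)))
        (≈-trans (reflexive (cong ⟦_⟧ˡ eq)) (≈-trans (reduce-correct v false []) (identityʳ ⟦ v ⟧)))

pattern X₀ = var Fin.zero
pattern X₁ = var (Fin.suc Fin.zero)
pattern X₂ = var (Fin.suc (Fin.suc Fin.zero))
pattern X₃ = var (Fin.suc (Fin.suc (Fin.suc Fin.zero)))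

-- Quasimorphisms that are small on quotients of commutators

module _ {c ℓ} (G : Group c ℓ) where
  open Group G

  commutator : Carrier → Carrier → Carrier
  commutator x y = x ∙ y ∙ x ⁻¹ ∙ y ⁻¹

  Commutators : Pred Carrier (c ⊔ ℓ)
  Commutators z = ∃[ x ] ∃[ y ] z ≈ commutator x y

  -- The colour may depend on the proof of membership, since it is read off from a chosen translate
  -- or factorisation. Right quotients `x ∙ y ⁻¹` are used because a common right factor cancels in
  -- them.
  ColouredBy : ∀ {p q} → ℕ → Pred Carrier p → Pred Carrier q → Set (c ⊔ p ⊔ q)
  ColouredBy N X S = Σ[ colour ∈ (∀ {x} → x ∈ X → Fin N) ]
    (∀ {x y} (x∈X : x ∈ X) (y∈X : y ∈ X) → colour x∈X ≡ colour y∈X → (x ∙ y ⁻¹) ∈ S)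

module _ {c ℓ} (G : Group c ℓ) where
  open Group G renaming (refl to ≈-refl; sym to ≈-sym; trans to ≈-trans)
  open MonoidMult monoid using (×-homo-+) renaming (_×_ to infixr 8 _×ᴳ_)
  open FreeReduction G

  commutator-cong : ∀ {x x′ y y′} → x ≈ x′ → y ≈ y′ → commutator G x y ≈ commutator G x′ y′
  commutator-cong x≈ y≈ = ∙-cong (∙-cong (∙-cong x≈ y≈) (⁻¹-cong x≈)) (⁻¹-cong y≈)

  conj-× : ∀ k x y → k ×ᴳ (x ∙ y ∙ x ⁻¹) ≈ x ∙ (k ×ᴳ y) ∙ x ⁻¹
  conj-× zero    x y = ≈-sym (≈-trans (∙-congʳ (identityʳ x)) (inverseʳ x))
  conj-× (suc k) x y = ≈-trans (∙-congˡ (conj-× k x y))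
    (by-reduction (x ∷ y ∷ (k ×ᴳ y) ∷ [])
      ((X₀ ⊙ X₁ ⊙ X₀ ⊖) ⊙ (X₀ ⊙ X₂ ⊙ X₀ ⊖)) (X₀ ⊙ (X₁ ⊙ X₂) ⊙ X₀ ⊖) refl)

  module _ (φ : Carrier → ℝ) where

    defectᴿ : Carrier → Carrier → ℝ
    defectᴿ x y = (φ (x ∙ y) -ᴿ φ x) -ᴿ φ y

    module Homogeneous
      (φ-cong : ∀ {x y} → x ≈ y → φ x ≈ᴿ φ y)
      {B : ℚ} (defect≺B : ∀ x y → defectᴿ x y ≺ B)
      (φ-× : ∀ k x → φ (k ×ᴳ x) ≈ᴿ k ×ᴿ φ x)
      where

      φ-ε : φ ε ≈ᴿ fromℚ 0ℚ
      φ-ε = φ-× 0 ε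

      -- The difference is the sum of the defects at `(x ∙ y , x ⁻¹)` and `(x , y)` minus that at
      -- `(x , x ⁻¹)`, because `φ` vanishes at `ε`. The bound is uniform in `y`.
      conj-defects : ∀ x y → φ (x ∙ y ∙ x ⁻¹) -ᴿ φ y ≺ (B ℚ.+ B) ℚ.+ B
      conj-defects x y =
        ≺-resp-≈ (≈-from (ℝᴳ.sym (ℝᴳ.trans (φ-cong (inverseʳ x)) φ-ε)) λ n →
            solve 6 (λ xyx′ xy x′ x y 𝟙 →
              ((((xyx′ :- xy) :- x′) :+ ((xy :- x) :- y)) :- ((𝟙 :- x) :- x′)) :- (xyx′ :- y)
              := con 0ℚ :- 𝟙) refl
              (seq (φ (x ∙ y ∙ x ⁻¹)) n) (seq (φ (x ∙ y)) n) (seq (φ (x ⁻¹)) n)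
              (seq (φ x) n) (seq (φ y) n) (seq (φ (x ∙ x ⁻¹)) n))
          (≺-- {y = defectᴿ x (x ⁻¹)}
            (≺-+ {x = defectᴿ (x ∙ y) (x ⁻¹)} (defect≺B (x ∙ y) (x ⁻¹)) (defect≺B x y)) (defect≺B x (x ⁻¹)))

      -- Conjugation commutes with powers, so `conj-defects` for the powers of `y` bounds all
      -- multiples of the difference by the same constant.
      conj-invariant : ∀ x y → φ (x ∙ y ∙ x ⁻¹) ≈ᴿ φ y
      conj-invariant x y = ≈0⇒≈ (×-bounded⇒≈0 λ k →
        ≺-resp-≈
          (ℝᴳ.sym (ℝᴳ.trans (×ᴿ-sub (suc k) (φ (x ∙ y ∙ x ⁻¹)) (φ y))
            (ℝᴳ.∙-cong
              (ℝᴳ.trans (ℝᴳ.sym (φ-× (suc k) (x ∙ y ∙ x ⁻¹))) (φ-cong (conj-× (suc k) x y)))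
              (ℝᴳ.⁻¹-cong (ℝᴳ.sym (φ-× (suc k) y))))))
          (conj-defects x (suc k ×ᴳ y)))

      -- The product `commutator G x y ∙ y` is the conjugate `x ∙ y ∙ x ⁻¹`, on which `φ` takes the
      -- value `φ y`. Hence a value at a commutator is, up to sign, a defect.
      φ-commutator : ∀ x y → φ (commutator G x y) ≈ᴿ -ᴿ defectᴿ (commutator G x y) y
      φ-commutator x y =
        ≈-from (ℝᴳ.trans (φ-cong (by-reduction (x ∷ y ∷ [])
            ((X₀ ⊙ X₁ ⊙ X₀ ⊖ ⊙ X₁ ⊖) ⊙ X₁) (X₀ ⊙ X₁ ⊙ X₀ ⊖) refl)) (conj-invariant x y)) λ n →
          solve 3 (λ c y cy → c :- (:- ((cy :- c) :- y)) := cy :- y) refl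
            (seq (φ (commutator G x y)) n) (seq (φ y) n) (seq (φ (commutator G x y ∙ y)) n)

      κ : Carrier → Carrier → ℕ → Carrier
      κ b a k = commutator G (k ×ᴳ b) a

      κ-1 : ∀ b a → κ b a 1 ≈ commutator G b a
      κ-1 b a = commutator-cong (identityʳ b) ≈-refl

      κ-suc : ∀ b a k → κ b a (suc k) ≈ (b ∙ κ b a k ∙ b ⁻¹) ∙ commutator G b a
      κ-suc b a k = by-reduction (b ∷ a ∷ (k ×ᴳ b) ∷ [])
        ((X₀ ⊙ X₂) ⊙ X₁ ⊙ (X₀ ⊙ X₂) ⊖ ⊙ X₁ ⊖)
        ((X₀ ⊙ (X₂ ⊙ X₁ ⊙ X₂ ⊖ ⊙ X₁ ⊖) ⊙ X₀ ⊖) ⊙ (X₀ ⊙ X₁ ⊙ X₀ ⊖ ⊙ X₁ ⊖)) refl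

      κ-quotient : ∀ b a i m →
        κ b a (i ℕ.+ m) ∙ κ b a i ⁻¹ ≈ (i ×ᴳ b) ∙ κ b a m ∙ (i ×ᴳ b) ⁻¹
      κ-quotient b a i m = ≈-trans (∙-congʳ (commutator-cong (×-homo-+ b i m) ≈-refl))
        (by-reduction ((i ×ᴳ b) ∷ a ∷ (m ×ᴳ b) ∷ [])
          (((X₀ ⊙ X₂) ⊙ X₁ ⊙ (X₀ ⊙ X₂) ⊖ ⊙ X₁ ⊖) ⊙ (X₀ ⊙ X₁ ⊙ X₀ ⊖ ⊙ X₁ ⊖) ⊖)
          (X₀ ⊙ (X₂ ⊙ X₁ ⊙ X₂ ⊖ ⊙ X₁ ⊖) ⊙ X₀ ⊖) refl)

      small-κ : ∀ {N ε′} → ColouredBy G N (Commutators G) (λ z → φ z ≺ ε′) →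
                ∀ b a → ∃[ r ] (suc r ℕ.≤ N × φ (κ b a (suc r)) ≺ ε′)
      small-κ {N} (colour , small) b a =
        let κ∈ = λ (i : Fin (suc N)) → (toℕ i ×ᴳ b , a , ≈-refl {κ b a (toℕ i)})
            -- The `N + 1` exponents 0 to `N` share `N` colours. For `i < j` of equal colour the
            -- exponent found is `j - i`, written `suc r`.
            i , j , i<j , eq = Fin.pigeonhole (ℕ.n<1+n N) (λ i → colour (κ∈ i))
            r , j≡ = ℕ.m≤n⇒∃[o]m+o≡n i<j
            j≡i+r = trans (sym j≡) (sym (ℕ.+-suc (toℕ i) r))
        in r ,
           ℕ.≤-trans (ℕ.≤-trans (ℕ.m≤n+m (suc r) (toℕ i)) (ℕ.≤-reflexive (sym j≡i+r)))
             (ℕ.≤-pred (Fin.toℕ<n j)) ,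
           ≺-resp-≈
             (ℝᴳ.trans
               (φ-cong (≈-trans (∙-congʳ (reflexive (cong (κ b a) j≡i+r)))
                 (κ-quotient b a (toℕ i) (suc r))))
               (conj-invariant (toℕ i ×ᴳ b) (κ b a (suc r))))
             (small (κ∈ j) (κ∈ i) (sym eq))

      -- The third power is the first that helps: `(xy)² = (x [y, x] x⁻¹) x² y²` would bound twice
      -- the defect by two other defects and a commutator term, which leaves no gain.
      cube : ∀ x y → 3 ×ᴳ (x ∙ y) ≈
        (x ∙ commutator G (y ∙ x ∙ y) (x ∙ y ⁻¹) ∙ x ⁻¹) ∙ (3 ×ᴳ x ∙ 3 ×ᴳ y)
      cube x y = by-reduction (x ∷ y ∷ [])
        (X₀ ⊙ X₁ ⊙ (X₀ ⊙ X₁ ⊙ (X₀ ⊙ X₁ ⊙ one)))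
        ((X₀ ⊙ (P ⊙ Q ⊙ P ⊖ ⊙ Q ⊖) ⊙ X₀ ⊖) ⊙
          (X₀ ⊙ (X₀ ⊙ (X₀ ⊙ one)) ⊙ (X₁ ⊙ (X₁ ⊙ (X₁ ⊙ one))))) refl
        where
        P Q : Word 2
        P = X₁ ⊙ X₀ ⊙ X₁
        Q = X₀ ⊙ X₁ ⊖

      -- By homogeneity the left side is `φ((xy)³) - φ(x³) - φ(y³)`. Splitting the first term along
      -- `cube` costs two defects, and the conjugate of `w` contributes `φ w`.
      3d≈ : ∀ x y → let w = commutator G (y ∙ x ∙ y) (x ∙ y ⁻¹) in
        3 ×ᴿ defectᴿ x y ≈ᴿ
        (defectᴿ (x ∙ w ∙ x ⁻¹) (3 ×ᴳ x ∙ 3 ×ᴳ y) +ᴿ φ w) +ᴿ defectᴿ (3 ×ᴳ x) (3 ×ᴳ y)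
      3d≈ x y =
        ≈-from
          (ℝᴳ.∙-cong
            (ℝᴳ.∙-cong (ℝᴳ.trans (ℝᴳ.sym (φ-× 3 (x ∙ y))) (φ-cong (cube x y))) (conj-invariant x w))
            (ℝᴳ.∙-cong (φ-× 3 x) (φ-× 3 y))) λ n →
          solve 9 (λ xy x y p c w x³ y³ x³y³ →
            3× ((xy :- x) :- y) :- ((((p :- c) :- x³y³) :+ w) :+ ((x³y³ :- x³) :- y³))
            := ((3× xy :+ c) :+ (x³ :+ y³)) :- ((p :+ w) :+ (3× x :+ 3× y))) refl
            (seq (φ (x ∙ y)) n) (seq (φ x) n) (seq (φ y) n)
            (seq (φ ((x ∙ w ∙ x ⁻¹) ∙ (3 ×ᴳ x ∙ 3 ×ᴳ y))) n) (seq (φ (x ∙ w ∙ x ⁻¹)) n) (seq (φ w) n)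
            (seq (φ (3 ×ᴳ x)) n) (seq (φ (3 ×ᴳ y)) n) (seq (φ (3 ×ᴳ x ∙ 3 ×ᴳ y)) n)
        where
        w = commutator G (y ∙ x ∙ y) (x ∙ y ⁻¹)
        3× : ∀ {n} → Polynomial n → Polynomial n
        3× p = p :+ (p :+ (p :+ con 0ℚ))

      module _ {D} (defect≺D : ∀ x y → defectᴿ x y ≺ D) where

        -- Induction on `r` with accumulator `v`: by `κ-suc`, lowering the exponent by one moves a
        -- copy of `φ (commutator G b a)` into `v` and adds one defect bound `D` to `s`.
        κ-chain : ∀ b a r v s → φ (κ b a (suc r)) +ᴿ v ≺ s →
                  suc r ×ᴿ φ (commutator G b a) +ᴿ v ≺ s ℚ.+ ι r ℚ.* D
        κ-chain b a zero v s h = subst (_ ≺_)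
          (solve 2 (λ s D → s := s :+ con 0ℚ :* D) refl s D)
          (≺-resp-≈ (≈-from (φ-cong (κ-1 b a)) λ n →
            solve 3 (λ k c v → (k :+ v) :- ((c :+ con 0ℚ) :+ v) := k :- c) refl
              (seq (φ (κ b a 1)) n) (seq (φ (commutator G b a)) n) (seq v n)) h)
        κ-chain b a (suc r) v s h = subst (_ ≺_)
          (trans (solve 3 (λ s D r → (s :+ D) :+ r :* D := s :+ (con 1ℚ :+ r) :* D) refl s D (ι r))
            (cong (λ z → s ℚ.+ z ℚ.* D) (sym (ι-suc r))))
          (≺-resp-≈ (≈-from (ℝᴳ.refl {v}) λ n →
              solve 4 (λ R c v 𝟘 → (R :+ (c :+ v)) :- ((c :+ R) :+ v) := 𝟘 :- 𝟘) refl
                (seq (suc r ×ᴿ φ w) n) (seq (φ w) n) (seq v n) (seq v n))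
            (κ-chain b a r (φ w +ᴿ v) (s ℚ.+ D)
              (≺-resp-≈ (≈-from
                  (ℝᴳ.∙-cong (φ-cong (κ-suc b a (suc r))) (conj-invariant b (κ b a (suc r)))) λ n →
                  solve 6 (λ K K′ k k′ c v →
                    ((K :+ v) :- ((K′ :- k) :- c)) :- (k′ :+ (c :+ v)) := (K :+ k) :- (K′ :+ k′)) refl
                    (seq (φ (κ b a (suc (suc r)))) n)
                    (seq (φ ((b ∙ κ b a (suc r) ∙ b ⁻¹) ∙ w)) n)
                    (seq (φ (b ∙ κ b a (suc r) ∙ b ⁻¹)) n) (seq (φ (κ b a (suc r))) n) (seq (φ w) n) (seq v n))
                (≺-- {y = defectᴿ (b ∙ κ b a (suc r) ∙ b ⁻¹) w} h (defect≺D _ _)))))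
          where w = commutator G b a

        -- With `m = suc r` from `small-κ`, `3m` times the defect is bounded by
        -- `2mD + (ε′ + (m - 1)D) = (3m - 1)D + ε′`. For `D = D′ + τ` this equals
        -- `3mD′ + (3mτ + ε′ - D′) - τ`, at most `3mD′` since `m ≤ N`.
        defect-improve : ∀ {N ε′ τ D′} → 0ℚ ℚ.≤ τ → D ≡ D′ ℚ.+ τ → ι N ℚ.* (ι 3 ℚ.* τ) ℚ.+ ε′ ℚ.≤ D′ →
                  ColouredBy G N (Commutators G) (λ z → φ z ≺ ε′) →
                  ∀ x y → defectᴿ x y ≺ D′
        defect-improve {N} {ε′} {τ} {D′} 0≤τ D≡D′+τ h coloured x y =
          let r , r<N , φκ≺ε′ = small-κ coloured (y ∙ x ∙ y) (x ∙ y ⁻¹)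
              rw≺ : suc r ×ᴿ φ w ≺ ε′ ℚ.+ ι r ℚ.* D
              rw≺ = ≺-resp-≈ (ℝᴳ.identityʳ (suc r ×ᴿ φ w))
                (κ-chain (y ∙ x ∙ y) (x ∙ y ⁻¹) r (fromℚ 0ℚ) ε′
                  (≺-resp-≈ (ℝᴳ.sym (ℝᴳ.identityʳ (φ (κ (y ∙ x ∙ y) (x ∙ y ⁻¹) (suc r))))) φκ≺ε′))
              r3d≺ = ≺-resp-≈ (ℝᴳ.sym (r3d≈ r))
                (≺-+ {x = suc r ×ᴿ d₁ +ᴿ suc r ×ᴿ φ w} (≺-+ {x = suc r ×ᴿ d₁} (≺-× r {d₁} (defect≺D _ _)) rw≺)
                  (≺-× r {d₂} (defect≺D _ _)))
          in ≺-×-cancel 2 (≺-×-cancel r (≺-mono {suc r ×ᴿ 3 ×ᴿ defectᴿ x y} (bound r r<N) r3d≺))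
          where
          w x³ y³ : Carrier
          w  = commutator G (y ∙ x ∙ y) (x ∙ y ⁻¹)
          x³ = 3 ×ᴳ x
          y³ = 3 ×ᴳ y
          d₁ d₂ : ℝ
          d₁ = defectᴿ (x ∙ w ∙ x ⁻¹) (x³ ∙ y³)
          d₂ = defectᴿ x³ y³

          r3d≈ : ∀ r → suc r ×ᴿ 3 ×ᴿ defectᴿ x y ≈ᴿ (suc r ×ᴿ d₁ +ᴿ suc r ×ᴿ φ w) +ᴿ suc r ×ᴿ d₂
          r3d≈ r = ℝᴳ.trans (×ᴿ-congʳ (suc r) (3d≈ x y))
            (ℝᴳ.trans (×ᴿ-distrib-+ (d₁ +ᴿ φ w) d₂ (suc r))
              (ℝᴳ.∙-congʳ (×ᴿ-distrib-+ d₁ (φ w) (suc r))))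

          bound : ∀ r → suc r ℕ.≤ N →
                  (ι (suc r) ℚ.* D ℚ.+ (ε′ ℚ.+ ι r ℚ.* D)) ℚ.+ ι (suc r) ℚ.* D ℚ.≤
                  ι (suc r) ℚ.* (ι 3 ℚ.* D′)
          bound r r<N = ℚ.≤-trans
            (ℚ.≤-reflexive (trans
              (cong₂ (λ μ D → (μ ℚ.* D ℚ.+ (ε′ ℚ.+ ι r ℚ.* D)) ℚ.+ μ ℚ.* D) (ι-suc r) D≡D′+τ)
              (trans
                (solve 4 (λ ρ D′ τ e →
                  ((con 1ℚ :+ ρ) :* (D′ :+ τ) :+ (e :+ ρ :* (D′ :+ τ))) :+ (con 1ℚ :+ ρ) :* (D′ :+ τ)
                  := ((con 1ℚ :+ ρ) :* (con (ι 3) :* D′) :+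
                     (((con 1ℚ :+ ρ) :* (con (ι 3) :* τ) :+ e) :- D′)) :- τ)
                  refl (ι r) D′ τ ε′)
                (cong (λ μ → (μ ℚ.* (ι 3 ℚ.* D′) ℚ.+ ((μ ℚ.* (ι 3 ℚ.* τ) ℚ.+ ε′) ℚ.- D′)) ℚ.- τ)
                  (sym (ι-suc r))))))
            (ℚ.≤-trans
              (ℚ.+-mono-≤
                (ℚ.+-monoʳ-≤ (ι (suc r) ℚ.* (ι 3 ℚ.* D′))
                  (ℚ.≤-trans
                    (ℚ.+-monoˡ-≤ (ℚ.- D′)
                      (ℚ.≤-trans
                        (ℚ.+-monoˡ-≤ ε′ (ℚ.*-monoʳ-≤-nonNeg (ι 3 ℚ.* τ) {{3τ-nonNeg}} (ι-mono r<N)))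
                        h))
                    (ℚ.≤-reflexive (ℚ.+-inverseʳ D′))))
                (ℚ.neg-antimono-≤ 0≤τ))
              (ℚ.≤-reflexive (trans (ℚ.+-identityʳ _) (ℚ.+-identityʳ _))))
            where
            3τ-nonNeg : ℚ.NonNegative (ι 3 ℚ.* τ)
            3τ-nonNeg = ℚ.nonNeg*nonNeg⇒nonNeg (ι 3) τ {{ℚ.nonNegative 0≤τ}}

      -- Each round removes one `τ`. The same colouring serves in all rounds, because the condition
      -- on `q` implies the one on every larger target `q + jτ`.
      defect-descent : ∀ {N ε′ τ q} → 0ℚ ℚ.≤ τ → ι N ℚ.* (ι 3 ℚ.* τ) ℚ.+ ε′ ℚ.≤ q →
                ColouredBy G N (Commutators G) (λ z → φ z ≺ ε′) →
                ∀ j → (∀ x y → defectᴿ x y ≺ q ℚ.+ ι j ℚ.* τ) → ∀ x y → defectᴿ x y ≺ q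
      defect-descent {τ = τ} {q} 0≤τ h coloured zero bd x y =
        subst (_ ≺_) (solve 2 (λ q τ → q :+ con 0ℚ :* τ := q) refl q τ) (bd x y)
      defect-descent {τ = τ} {q} 0≤τ h coloured (suc j) bd =
        defect-descent 0≤τ h coloured j
          (defect-improve bd 0≤τ
            (trans (cong (λ z → q ℚ.+ z ℚ.* τ) (ι-suc j))
              (solve 3 (λ q j τ → q :+ (con 1ℚ :+ j) :* τ := (q :+ j :* τ) :+ τ) refl q (ι j) τ))
            (ℚ.≤-trans h (ℚ.≤-trans (ℚ.≤-reflexive (sym (ℚ.+-identityʳ q)))
              (ℚ.+-monoʳ-≤ q (ℚ.nonNegative⁻¹ (ι j ℚ.* τ) {{jτ-nonNeg}}))))
            coloured)
        where
        jτ-nonNeg : ℚ.NonNegative (ι j ℚ.* τ)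
        jτ-nonNeg = ℚ.nonNeg*nonNeg⇒nonNeg (ι j) {{ℚ.normalize-nonNeg j 1}} τ {{ℚ.nonNegative 0≤τ}}

      defect≈0 : (∀ ε′ → 0ℚ ℚ.< ε′ → ∃[ N ] ColouredBy G N (Commutators G) (λ z → φ z ≺ ε′)) →
                 ∀ x y → defectᴿ x y ≈ᴿ fromℚ 0ℚ
      defect≈0 coloured x y = ≺⇒≈0 λ q 0<q →
        let ε′ , 0<ε′ , 2ε′≡q = fraction-pos 1 0<q
            N , colouring = coloured ε′ 0<ε′
            -- The step `τ = ε′ / (3(N + 1))` gives `3Nτ + ε′ ≤ 2ε′ = q`; dividing by `N + 1` also
            -- covers `N = 0`.
            σ , 0<σ , Nσ≡ε′ = fraction-pos N 0<ε′
            τ , 0<τ , 3τ≡σ = fraction-pos 2 0<σ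
            -- After `suc j` rounds the initial bound `B ≤ q + (j + 1)τ` has come down to `q`.
            j , B≤jτ = archimedean B 0<τ
            0≤σ = ℚ.nonNegative (ℚ.<⇒≤ 0<σ)
        in defect-descent {N} (ℚ.<⇒≤ 0<τ)
             (ℚ.≤-trans
               (ℚ.+-monoˡ-≤ ε′ (ℚ.≤-trans
                 (ℚ.≤-reflexive (cong (ι N ℚ.*_) 3τ≡σ))
                 (ℚ.≤-trans (ℚ.*-monoʳ-≤-nonNeg σ {{0≤σ}} (ι-mono (ℕ.n≤1+n N))) (ℚ.≤-reflexive Nσ≡ε′))))
               (ℚ.≤-reflexive (trans (solve 1 (λ e → e :+ e := con (ι 2) :* e) refl ε′) 2ε′≡q)))
             colouring (suc j)
             (λ x y → ≺-mono {defectᴿ x y}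
               (ℚ.≤-trans B≤jτ (ℚ.≤-trans (ℚ.≤-reflexive (sym (ℚ.+-identityˡ _)))
                 (ℚ.+-monoˡ-≤ _ (ℚ.<⇒≤ 0<q))))
               (defect≺B x y))
             x y

-- Compact sets and finite covers

-- The open slabs given by `v i ≺ q` for rational `q` cover everything; the largest `q` of a finite
-- subcover is a bound.
compact⇒bounded : ∀ {n p w} {W : Pred (ℝ^.Carrier n) w} → ℝ^ᵗ.IsCompact n p W →
                  ∀ i → ∃[ q ] (∀ {v} → v ∈ W → v i ≺ q)
compact⇒bounded {n} {p} {W = W} W-compact i =
  let Vs , slabs , cover = finiteSubcover
        (λ V → ∃[ q ] V ≡ Slab q)
        (λ { (q , refl) → Slab-open q })
        (λ {v} _ → let q , vi≺q = bounded (v i) in Slab q , (q , refl) , lift vi≺q)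
      q , h = bound slabs
  in q , λ v∈W → h (cover v∈W)
  where
  open Topology.IsCompact W-compact

  Slab : ℚ → Pred (ℝ^.Carrier n) p
  Slab q v = Lift p (v i ≺ q)

  Slab-open : ∀ q → ℝ^ᵗ.IsOpen n p (Slab q)
  Slab-open q {v} (lift vi≺q) =
    let δ , 0<δ , vi≺q-δ = ≺-shrink vi≺q
    in δ , 0<δ , λ {u} u∈Ball → lift (subst (_ ≺_)
         (solve 2 (λ q δ → (q :- δ) :+ δ := q) refl q δ)
         (≺-resp-≈ (≈-from (ℝᴳ.refl {v i}) λ m →
             solve 2 (λ v u → (v :- (v :- u)) :- u := v :- v) refl (seq (v i) m) (seq (u i) m))
           (≺-- {y = v i -ᴿ u i} vi≺q-δ (u∈Ball i))))

  bound : ∀ {Vs} → All (λ V → ∃[ q ] V ≡ Slab q) Vs → ∃[ q ] (∀ {v} → Any (v ∈_) Vs → v i ≺ q)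
  bound []                 = 0ℚ , λ ()
  bound ((q , refl) ∷ slabs) =
    let q′ , h = bound slabs
    in q ℚ.⊔ q′ , λ
         { {v} (here (lift vi≺q)) → ≺-mono {v i} (ℚ.p≤p⊔q q q′) vi≺q
         ; {v} (there v∈)         → ≺-mono {v i} (ℚ.p≤q⊔p q q′) (h v∈) }

-- Neighbourhoods of the identity and colourings of compact sets in topological groups

module _ {a t} (L : TopologicalGroup a t) where
  open TopologicalGroup L
  open Group group renaming (refl to ≈-refl; sym to ≈-sym; trans to ≈-trans)
  open MonoidMult monoid using () renaming (_×_ to infixr 8 _×ᴳ_)

  OpenNeighbourhoodOfε : Pred (Pred Carrier a) (a ⊔ t)
  OpenNeighbourhoodOfε V = IsOpen V × ε ∈ V

  product-neighbourhood : ∀ {O} → OpenNeighbourhoodOfε O →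
    ∃[ V ] (OpenNeighbourhoodOfε V × (∀ {x y} → x ∈ V → y ∈ V → (x ∙ y) ∈ O))
  product-neighbourhood (O-open , ε∈O) =
    let P , Q , P-open , Q-open , ε∈P , ε∈Q , sub =
          ∙-continuous O-open (open-respects-≈ O-open (≈-sym (identityˡ ε)) ε∈O)
    in _ , (open-∩ P-open Q-open , ε∈P , ε∈Q) , λ (x∈P , _) (_ , y∈Q) → sub x∈P y∈Q

  -- Used to make `φ` small: a bound for `φ` at the `k`-th power of an element is divided by `k` at
  -- the element itself.
  power-neighbourhood : ∀ {O} k → OpenNeighbourhoodOfε O →
    ∃[ V ] (OpenNeighbourhoodOfε V × (∀ {x} → x ∈ V → (k ×ᴳ x) ∈ O))
  power-neighbourhood zero    O-nbhd@(_ , ε∈O) = _ , O-nbhd , λ _ → ε∈O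
  power-neighbourhood (suc k) O-nbhd =
    let V , V-nbhd , VV⊆O = product-neighbourhood O-nbhd
        V′ , (V′-open , ε∈V′) , kV′⊆V = power-neighbourhood k V-nbhd
    in _ , (open-∩ (proj₁ V-nbhd) V′-open , proj₂ V-nbhd , ε∈V′) ,
       λ (x∈V , x∈V′) → VV⊆O x∈V (kV′⊆V x∈V′)

  -- Multiplication is continuous at `(x ⁻¹ , x)`, whose product is `ε`; `A` is the part of the
  -- second factor `Q` whose inverses lie in the first factor `P`.
  quotient-neighbourhood : ∀ {V} → OpenNeighbourhoodOfε V → ∀ x →
    ∃[ A ] (IsOpen A × x ∈ A × (∀ {y y′} → y ∈ A → y′ ∈ A → (y ⁻¹ ∙ y′) ∈ V))
  quotient-neighbourhood (V-open , ε∈V) x =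
    let P , Q , P-open , Q-open , x⁻¹∈P , x∈Q , sub =
          ∙-continuous V-open (open-respects-≈ V-open (≈-sym (inverseˡ x)) ε∈V)
    in _ , open-∩ (⁻¹-continuous P-open) Q-open , (x⁻¹∈P , x∈Q) ,
       λ (y⁻¹∈P , _) (_ , y′∈Q) → sub y⁻¹∈P y′∈Q

  -- The sets of `quotient-neighbourhood` cover `W`; the colour of a point is its index in a finite
  -- subcover.
  compact-colouring : ∀ {w} {W : Pred Carrier w} {V} → IsCompact W → OpenNeighbourhoodOfε V →
    ∃[ N ] Σ[ colour ∈ (∀ {x} → x ∈ W → Fin N) ]
      (∀ {x y} (x∈W : x ∈ W) (y∈W : y ∈ W) → colour x∈W ≡ colour y∈W → (x ⁻¹ ∙ y) ∈ V)
  compact-colouring {V = V} W-compact V-nbhd =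
    let As , small , cover = finiteSubcover Small (λ (lift (A-open , _)) → A-open)
          (λ {x} _ → let A , A-open , x∈A , h = quotient-neighbourhood V-nbhd x
                     in A , lift (A-open , h) , x∈A)
    in List.length As , (λ x∈W → index (cover x∈W)) ,
       λ x∈W y∈W → same-member small (cover x∈W) (cover y∈W)
    where
    open IsCompact W-compact

    Small : Pred (Pred Carrier a) (lsuc a ⊔ t)
    Small A = Lift (lsuc a ⊔ t) (IsOpen A × (∀ {y y′} → y ∈ A → y′ ∈ A → (y ⁻¹ ∙ y′) ∈ V))

    same-member : ∀ {As x y} → All Small As → (p : Any (x ∈_) As) (q : Any (y ∈_) As) →
                  index p ≡ index q → (x ⁻¹ ∙ y) ∈ V
    same-member (lift (_ , h) ∷ _) (here x∈A) (here y∈A) _  = h x∈A y∈A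
    same-member (_ ∷ small)        (there p)  (there q)  eq = same-member small p q (Fin.suc-injective eq)

-- Colourings and bounds passed along covers by right translates

module _ {c ℓ} (G : Group c ℓ) where
  open Group G renaming (refl to ≈-refl; sym to ≈-sym; trans to ≈-trans)
  open FreeReduction G

  commensurable-refl : ∀ {p} (A : Pred Carrier p) → Commensurable G A A
  commensurable-refl A = self , self
    where
    self : CoveredByRightTranslatesOf G A A
    self = ε ∷ [] , λ {x} x∈A → here (x , ε , x∈A , ≈-refl , ≈-sym (identityʳ x))

  -- The colour records the translate together with the colour of the point of `B`. If `x = b d` and
  -- `y = b′ d`, then `x ∙ y ⁻¹ = b ∙ b′ ⁻¹`.
  cover-colouring : ∀ {p q s} {A : Pred Carrier p} {B : Pred Carrier q} {S : Pred Carrier s} {N} →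
    S Respects _≈_ → CoveredByRightTranslatesOf G A B → ColouredBy G N B S →
    ∃[ M ] ColouredBy G M A S
  cover-colouring {A = A} {B} {S} {N} resp (cs , cover) (colour , same) =
    List.length cs ℕ.* N , (λ x∈A → Fin.combine (index (cover x∈A)) (colour (base x∈A))) ,
    λ x∈A y∈A eq →
      let i≡j , eq′ = Fin.combine-injective _ _ _ _ eq
      in quotient x∈A y∈A i≡j (same (base x∈A) (base y∈A) eq′)
    where
    at : ∀ {x} (x∈A : x ∈ A) → x ∈ _·_ G B (List.lookup cs (index (cover x∈A)) ≈_)
    at x∈A = lookup-index (cover x∈A)

    base : ∀ {x} (x∈A : x ∈ A) → proj₁ (at x∈A) ∈ B
    base x∈A = proj₁ (proj₂ (proj₂ (at x∈A)))

    quotient : ∀ {x y} (x∈A : x ∈ A) (y∈A : y ∈ A) → index (cover x∈A) ≡ index (cover y∈A) →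
               (proj₁ (at x∈A) ∙ proj₁ (at y∈A) ⁻¹) ∈ S → (x ∙ y ⁻¹) ∈ S
    quotient {x} {y} x∈A y∈A i≡j =
      let b  , d  , _ , c≈d   , x≈bd   = at x∈A
          b′ , d′ , _ , c′≈d′ , y≈b′d′ = at y∈A
          d′≈d = ≈-trans (≈-sym c′≈d′) (≈-trans (reflexive (cong (List.lookup cs) (sym i≡j))) c≈d)
      in resp (≈-sym (≈-trans
           (∙-cong x≈bd (⁻¹-cong (≈-trans y≈b′d′ (∙-congˡ d′≈d))))
           (by-reduction (b ∷ b′ ∷ d ∷ []) (X₀ ⊙ X₂ ⊙ (X₁ ⊙ X₂) ⊖) (X₀ ⊙ X₁ ⊖) refl)))

  module _ (φ : Carrier → ℝ) where

    BoundedOn : ∀ {p} → Pred Carrier p → Set (c ⊔ p)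
    BoundedOn A = ∃[ q ] (∀ {x} → x ∈ A → φ x ≺ q)

    module BoundedDefect
      (φ-cong : ∀ {x y} → x ≈ y → φ x ≈ᴿ φ y)
      {B : ℚ} (defect≺B : ∀ x y → defectᴿ G φ x y ≺ B)
      (φ-ε : φ ε ≈ᴿ fromℚ 0ℚ)
      where

      ≺-∙ : ∀ {x y p q} → φ x ≺ p → φ y ≺ q → φ (x ∙ y) ≺ (p ℚ.+ q) ℚ.+ B
      ≺-∙ {x} {y} φx≺p φy≺q = ≺-resp-≈
        (≈-from (ℝᴳ.refl {φ x}) λ n →
          solve 3 (λ x y xy → ((x :+ y) :+ ((xy :- x) :- y)) :- xy := x :- x) refl
            (seq (φ x) n) (seq (φ y) n) (seq (φ (x ∙ y)) n))
        (≺-+ {x = φ x +ᴿ φ y} (≺-+ {x = φ x} φx≺p φy≺q) (defect≺B x y))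

      ≺-⁻¹ : ∀ {x q} → φ (x ⁻¹) ≺ q → φ x ≺ q ℚ.+ B
      ≺-⁻¹ {x} φx⁻¹≺q = ≺-resp-≈
        (≈-from (ℝᴳ.sym (ℝᴳ.trans (φ-cong (inverseʳ x)) φ-ε)) λ n →
          solve 3 (λ x x′ e → ((:- x′) :- ((e :- x) :- x′)) :- x := con 0ℚ :- e) refl
            (seq (φ x) n) (seq (φ (x ⁻¹)) n) (seq (φ (x ∙ x ⁻¹)) n))
        (≺-- {x = -ᴿ φ (x ⁻¹)} {y = defectᴿ G φ x (x ⁻¹)} (≺-neg {φ (x ⁻¹)} φx⁻¹≺q) (defect≺B x (x ⁻¹)))

      bounded-quotients : ∀ {p} {A : Pred Carrier p} → BoundedOn A → BoundedOn (_·_ G A (_⁻¹ˢ G A))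
      bounded-quotients (q , h) = _ , λ (x , y , x∈A , y⁻¹∈A , z≈xy) →
        ≺-resp-≈ (φ-cong (≈-sym z≈xy)) (≺-∙ {x} {y} (h x∈A) (≺-⁻¹ {y} (h y⁻¹∈A)))

      bounded-list : ∀ cs → ∃[ q ] (∀ i → φ (List.lookup cs i) ≺ q)
      bounded-list []       = 0ℚ , λ ()
      bounded-list (x ∷ xs) =
        let q  , φx≺q = bounded (φ x)
            q′ , h    = bounded-list xs
        in q ℚ.⊔ q′ , λ
             { Fin.zero    → ≺-mono {φ x} (ℚ.p≤p⊔q q q′) φx≺q
             ; (Fin.suc i) → ≺-mono {φ (List.lookup xs i)} (ℚ.p≤q⊔p q q′) (h i) }

      -- Right translation by `c` raises a bound for `φ` by at most a bound for `φ c` plus `B`, and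
      -- only finitely many `c` occur.
      cover-bounded : ∀ {p q} {A : Pred Carrier p} {B : Pred Carrier q} →
        CoveredByRightTranslatesOf G A B → BoundedOn B → BoundedOn A
      cover-bounded (cs , cover) (q , h) =
        let q′ , h′ = bounded-list cs
        in _ , λ x∈A →
          let b , d , b∈B , c≈d , x≈bd = lookup-index (cover x∈A)
          in ≺-resp-≈ (φ-cong (≈-sym x≈bd))
               (≺-∙ {b} {d} (h b∈B) (≺-resp-≈ (φ-cong c≈d) (h′ (index (cover x∈A)))))

-- Colourings pulled back along a homomorphism to a topological group

module _ {c ℓ a t} (G : Group c ℓ) (L : TopologicalGroup a t)
         (f : Group.Carrier G → Group.Carrier (TopologicalGroup.group L))
         (f-hom : IsGroupHomomorphism (Group.rawGroup G) (Group.rawGroup (TopologicalGroup.group L)) f)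
         where
  private module L where
    open TopologicalGroup L public
    open Group group public
  open Group G renaming (refl to ≈-refl; sym to ≈-sym; trans to ≈-trans)
  open IsGroupHomomorphism f-hom
  open MonoidMult monoid using () renaming (_×_ to infixr 8 _×ᴳ_)
  open MonoidMult L.monoid using () renaming (_×_ to infixr 8 _×ᴸ_)
  open FreeReduction G

  homo-× : ∀ k x → f (k ×ᴳ x) L.≈ k ×ᴸ f x
  homo-× zero    x = ε-homo
  homo-× (suc k) x = L.trans (homo x (k ×ᴳ x)) (L.∙-congˡ (homo-× k x))

  quotient-colouring : ∀ {w} {W : Pred L.Carrier w} →
    L.IsCompact W → W ∈ L.NeighbourhoodsOf (L.ε L.≈_) →
    (φ : Carrier → ℝ) → (∀ {x y} → x ≈ y → φ x ≈ᴿ φ y) →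
    (∀ x y → φ (x ∙ y ∙ x ⁻¹) ≈ᴿ φ y) → (∀ k x → φ (k ×ᴳ x) ≈ᴿ k ×ᴿ φ x) →
    BoundedOn G φ (f ⊢ W) → ∀ {δ} → 0ℚ ℚ.< δ →
    ∃[ N ] ColouredBy G N (_·_ G (f ⊢ W) (_⁻¹ˢ G (f ⊢ W))) (λ z → φ z ≺ δ)
  quotient-colouring {W = W} W-compact (O , O-open , ε⊆O , O⊆W) φ φ-cong conj-invariant φ-× (q , φ≺q) {δ} 0<δ =
    -- If `f x ∈ V`, then the power `x^(k+1)` is mapped into `W`, so `(k + 1) φ(x)` is bounded by
    -- `q ≤ (k + 1)δ`.
    let k , q≤kδ = archimedean q 0<δ
        V , V-nbhd , kV⊆O = power-neighbourhood L (suc k) (O-open , ε⊆O L.refl)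
        V′ , V′-nbhd , V′V′⊆V = product-neighbourhood L V-nbhd
        M , colour , same = compact-colouring L W-compact V′-nbhd
        small : ∀ {x} → f x ∈ V → φ x ≺ δ
        small {x} fx∈V = ≺-×-cancel k (≺-mono {suc k ×ᴿ φ x} q≤kδ
          (≺-resp-≈ (φ-× (suc k) x) (φ≺q (W-respects (L.sym (homo-× (suc k) x)) (O⊆W (kV⊆O fx∈V))))))
    in M ℕ.* M ,
       -- Here `y∈Z` says that `y ⁻¹` lies in the preimage of `W`, so the second colour is that of
       -- `f (y ⁻¹)`.
       (λ (_ , _ , x∈Z , y∈Z , _) → Fin.combine (colour x∈Z) (colour y∈Z)) ,
       λ (x , y , x∈Z , y∈Z , z≈xy) (x′ , y′ , x′∈Z , y′∈Z , z′≈x′y′) eq →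
         let eqˣ , eqʸ = Fin.combine-injective _ _ _ _ eq
         -- Conjugating by `x′` turns the right quotient of `x ∙ y` and `x′ ∙ y′` into
         -- `(x′⁻¹ x)(y y′⁻¹)`. The colours control exactly these two factors, whose images lie in
         -- `V′`.
         in ≺-resp-≈
              (ℝᴳ.trans
                (ℝᴳ.sym (conj-invariant x′ ((x′ ⁻¹ ∙ x) ∙ (y ⁻¹ ⁻¹ ∙ y′ ⁻¹))))
                (φ-cong (≈-sym (≈-trans (∙-cong z≈xy (⁻¹-cong z′≈x′y′))
                  (by-reduction (x ∷ y ∷ x′ ∷ y′ ∷ [])
                    (X₀ ⊙ X₁ ⊙ (X₂ ⊙ X₃) ⊖)
                    (X₂ ⊙ ((X₂ ⊖ ⊙ X₀) ⊙ (X₁ ⊖ ⊖ ⊙ X₃ ⊖)) ⊙ X₂ ⊖) refl)))))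
              (small (L.open-respects-≈ (proj₁ V-nbhd)
                (L.sym (L.trans (homo (x′ ⁻¹ ∙ x) (y ⁻¹ ⁻¹ ∙ y′ ⁻¹))
                  (L.∙-cong (homo-quotient x′ x) (homo-quotient (y ⁻¹) (y′ ⁻¹)))))
                (V′V′⊆V (same x′∈Z x∈Z (sym eqˣ)) (same y∈Z y′∈Z eqʸ))))
    where
    W-respects = L.IsCompact.respects-≈ W-compact

    homo-quotient : ∀ x y → f (x ⁻¹ ∙ y) L.≈ f x L.⁻¹ L.∙ f y
    homo-quotient x y = L.trans (homo (x ⁻¹) y) (L.∙-congʳ (⁻¹-homo x))

-- Comparison of the preimages under `g` and `f`, one coordinate of `g` at a time

×-pointwise : ∀ {n} k (v : ℝ^.Carrier n) i → multiple (ℝ^.rawMonoid n) k v i ≡ k ×ᴿ v i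
×-pointwise zero    v i = refl
×-pointwise (suc k) v i = cong (v i +ᴿ_) (×-pointwise k v i)

proposition5p29 : {a t w : Level} (G : Group a a)
    (ω : Pred (Pred (Group.Carrier G) a) w) → IsCommensurabilityClass G ω →
    (n : ℕ) (g : Group.Carrier G → ℝ^.Carrier n) →
    IsHomogeneousQuasimorphism G g → Isχ-quasimorphism G g ω →
    (L : TopologicalGroup a t) →
    IsLocallyCompactGroup L → TopologicalGroup.IsConnected L →
    (f : Group.Carrier G → Group.Carrier (TopologicalGroup.group L)) →
    IsGroupHomomorphism (Group.rawGroup G) (Group.rawGroup (TopologicalGroup.group L)) f →
    TopologicalGroup.HasDenseImage L f → Isχ-homomorphism G L f ω →
    IsGroupHomomorphism (Group.rawGroup G) (ℝ^.rawGroup n) g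
proposition5p29 G ω (Λ , Λ-approximate , _ , Λ-class⊆ω) n g g-qm
  (K , W , K-error , W-compact , (O , _ , K⊆O , O⊆W) , ω⊆χg , _)
  L _ _ f f-hom _ (U , U-compact , U-nbhd , ω⊆χf , _) = record
  { isMonoidHomomorphism = record
    { isMagmaHomomorphism = record
      { isRelHomomorphism = record { cong = g-cong }
      ; homo = λ x y i →
          ≈-from (Hom.defect≈0 i (commutator-colouring i) x y) λ m →
            solve 3 (λ xy x y → xy :- (x :+ y) := ((xy :- x) :- y) :- con 0ℚ) refl
              (seq (g (x ∙ y) i) m) (seq (g x i) m) (seq (g y i) m)
      }
    ; ε-homo = homogeneous ε (+ 0)
    }
  -- Homogeneity for the exponent -1, where `zpow` computes to `(x ∙ ε) ⁻¹`.
  ; ⁻¹-homo = λ x i → ℝᴳ.trans (g-cong (⁻¹-cong (≈-sym (identityʳ x))) i)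
      (ℝᴳ.trans (homogeneous x -[1+ 0 ] i) (ℝᴳ.⁻¹-cong (ℝᴳ.identityʳ (g x i))))
  }
  where
  open Group G renaming (refl to ≈-refl; sym to ≈-sym; trans to ≈-trans)
  open FreeReduction G
  open IsHomogeneousQuasimorphism g-qm
  open IsCompactErrorSet K-error

  Y = g ⊢ W
  Z = f ⊢ U

  -- This one member links the two descriptions of `ω`: it is commensurable both to the quotients of
  -- `Y` and to those of `Z`.
  Λ∈ω : Λ ∈ ω
  Λ∈ω = Λ-class⊆ω (Λ-approximate , commensurable-refl G Λ)

  g-× : ∀ i k x → g (multiple rawMonoid k x) i ≈ᴿ k ×ᴿ g x i
  g-× i k x = ℝᴳ.trans (homogeneous x (+ k) i) (ℝᴳ.reflexive (×-pointwise k (g x) i))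

  module Hom (i : Fin n) =
    Homogeneous G (λ x → g x i) (λ x≈y → g-cong x≈y i)
      (λ x y → proj₂ boundedDefect x y i)
      (g-× i)

  module Bdd (i : Fin n) =
    BoundedDefect G (λ x → g x i) (λ x≈y → g-cong x≈y i)
      (λ x y → proj₂ boundedDefect x y i) (Hom.φ-ε i)

  -- By `Hom.φ-commutator` the value of `g` is the negative of a defect, so it lies in the symmetric
  -- set `K`, which `W` contains.
  Commutators⊆Y : Commutators G ⊆ Y
  Commutators⊆Y (x , y , z≈[x,y]) = O⊆W (K⊆O (Topology.IsCompact.respects-≈ compact
    (λ i → ℝᴳ.sym (ℝᴳ.trans (g-cong z≈[x,y] i) (Hom.φ-commutator i x y)))
    (proj₁ symmetric (defect∈K (commutator G x y) y))))

  Commutators⊆YY⁻¹ : Commutators G ⊆ _·_ G Y (_⁻¹ˢ G Y)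
  Commutators⊆YY⁻¹ {z} z∈ = z , ε , Commutators⊆Y z∈ ,
    Commutators⊆Y (ε , ε , by-reduction [] (one ⊖) (one ⊙ one ⊙ one ⊖ ⊙ one ⊖) refl) ,
    ≈-sym (identityʳ z)

  Λ∼YY⁻¹ = proj₂ (ω⊆χg Λ∈ω)
  Λ∼ZZ⁻¹ = proj₂ (ω⊆χf Λ∈ω)

  Z⊆ZZ⁻¹ : Z ⊆ _·_ G Z (_⁻¹ˢ G Z)
  Z⊆ZZ⁻¹ {z} z∈Z = z , ε , z∈Z , U∋f-ε⁻¹ , ≈-sym (identityʳ z)
    where
    module L = Group (TopologicalGroup.group L)
    U∋f-ε⁻¹ : f (ε ⁻¹) ∈ U
    U∋f-ε⁻¹ = let _ , _ , ε⊆O′ , O′⊆U = U-nbhd in O′⊆U (ε⊆O′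
      (L.sym (L.trans (IsGroupHomomorphism.⁻¹-homo f-hom ε)
        (L.trans (L.⁻¹-cong (IsGroupHomomorphism.ε-homo f-hom))
          (GroupProperties.ε⁻¹≈ε (TopologicalGroup.group L))))))

  bounded-Y : ∀ i → BoundedOn G (λ x → g x i) Y
  bounded-Y i = let q , h = compact⇒bounded W-compact i in q , λ y∈Y → h y∈Y

  -- Boundedness passes from `Y` to its quotients, then to `Λ`, to the quotients of `Z`, and to `Z`.
  bounded-Z : ∀ i → BoundedOn G (λ x → g x i) Z
  bounded-Z i =
    let q , h = Bdd.cover-bounded i (proj₂ Λ∼ZZ⁻¹) (Bdd.cover-bounded i (proj₁ Λ∼YY⁻¹)
                  (Bdd.bounded-quotients i (bounded-Y i)))
    in q , λ z∈Z → h (Z⊆ZZ⁻¹ z∈Z)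

  -- Colourings travel the opposite way, from the quotients of `Z` through `Λ` to the quotients of
  -- `Y`, which contain the commutators.
  commutator-colouring : ∀ i δ → 0ℚ ℚ.< δ → ∃[ N ] ColouredBy G N (Commutators G) (λ z → g z i ≺ δ)
  commutator-colouring i δ 0<δ =
    let _ , ZZ⁻¹-coloured = quotient-colouring G L f f-hom U-compact U-nbhd (λ x → g x i)
          (λ x≈y → g-cong x≈y i) (Hom.conj-invariant i)
          (g-× i)
          (bounded-Z i) 0<δ
        _ , Λ-coloured = cover-colouring G respects (proj₁ Λ∼ZZ⁻¹) ZZ⁻¹-coloured
        N , colour , same = cover-colouring G respects (proj₂ Λ∼YY⁻¹) Λ-coloured
    in N , (λ z∈ → colour (Commutators⊆YY⁻¹ z∈)) ,
       λ x∈ y∈ → same (Commutators⊆YY⁻¹ x∈) (Commutators⊆YY⁻¹ y∈)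
    where
    respects : (λ z → g z i ≺ δ) Respects _≈_
    respects x≈y = ≺-resp-≈ (g-cong x≈y i)
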